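{- Let $q \ge 2$ be an integer. Suppose that $\chi(\mathrm{KG}^q(n,k)_{\widetilde{q\text{ -stab}}}) = \left\lceil \frac{n - q(k-1)}{q-1} \right\rceil$ for all integers $k \ge 1$ and $n \ge qk$. Then for every path $P$ whose vertex set is partitioned into $m$ subsets $V_1, \dots, V_m$ of sizes at least $q-1$, there exist pairwise disjoint $q$-stable sets $S_1, \dots, S_q$ covering all but at most $q-1$ vertices of each $V_j$ and satisfying $|S_i \cap V_j| \ge \lfloor \frac{|V_j|+1}{q} \rfloor - 1$ for all $i \in \{1, \dots, q\}$ and $j \in \{1, \dots, m\}$. Moreover, for every $q$ that is a power of two, for every such path and partition there exist pairwise disjoint $q$-stable sets $S_1, \dots, S_q$ with these properties whose cardinalities additionally differ pairwise by at most one.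
   Context: A set $S$ of vertices of a path is $q$-stable if any two distinct vertices of $S$ are at distance at least $q$ in the path. $\mathrm{KG}^q(n,k)_{\widetilde{q\text{ -stab}}}$ is the $q$-uniform hypergraph whose vertices are the $k$-element subsets $F \subseteq \{1, \dots, n\}$ that are $q$-stable in the path $1 - 2 - \dots - n$ (i.e. any two distinct elements of $F$ differ by at least $q$), and whose hyperedges are the sets $\{F_1, \dots, F_q\}$ of $q$ pairwise disjoint such vertices. The (weak) chromatic number $\chi(H)$ of a hypergraph $H$ is the least number of colors in a coloring of its vertices such that no hyperedge is monochromatic. -}

module Defs where

open import Data.Nat using (ℕ; zero; suc; _+_; _*_; _∸_; _≤_; _/_; ∣_-_∣)
open import Data.Fin using (Fin; toℕ)
open import Data.Fin.Properties using (_≟_)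
open import Data.Fin.Subset using (Subset; _∈_; _∩_; ∁; ⋃; ∣_∣; Empty)
open import Data.Vec using (tabulate)
import Data.List as List
open import Data.Product using (Σ; _×_; proj₁)
open import Relation.Nullary using (¬_)
open import Relation.Nullary.Decidable using (⌊_⌋)
open import Relation.Binary.PropositionalEquality using (_≡_; _≢_)

-- Vertices of the path 0 - 1 - ... - (N-1) are the elements of Fin N;
-- the distance between x and y in the path is |x - y|.

Stable : (q : ℕ) {N : ℕ} → Subset N → Set
Stable q S = ∀ x y → x ∈ S → y ∈ S → x ≢ y → q ≤ ∣ toℕ x - toℕ y ∣

-- ceiling division ⌈ a / b ⌉ (only used with b ≥ 1; value 0 for b = 0)
ceilDiv : ℕ → ℕ → ℕ
ceilDiv a zero = 0
ceilDiv a (suc b) = (a + b) / suc b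

-- floor division ⌊ a / b ⌋ (only used with b ≥ 1; value 0 for b = 0)
floorDiv : ℕ → ℕ → ℕ
floorDiv a zero = 0
floorDiv a (suc b) = a / suc b

KGVertex : (q n k : ℕ) → Set
KGVertex q n k = Σ (Subset n) (λ F → ∣ F ∣ ≡ k × Stable q F)

PairwiseDisjoint : {r N : ℕ} → (Fin r → Subset N) → Set
PairwiseDisjoint S = ∀ i j → i ≢ j → Empty (S i ∩ S j)

-- a proper (weak) colouring with C colours: no hyperedge {F_1,...,F_q}
-- (q pairwise disjoint vertices) is monochromatic
ProperColouring : (q n k C : ℕ) → (KGVertex q n k → Fin C) → Set
ProperColouring q n k C col =
  ∀ (F : Fin q → KGVertex q n k) →
    PairwiseDisjoint (λ i → proj₁ (F i)) →
    ¬ (∀ i j → col (F i) ≡ col (F j))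

Colourable : (q n k C : ℕ) → Set
Colourable q n k C = Σ (KGVertex q n k → Fin C) (ProperColouring q n k C)

ChromaticNumberIs : (q n k c : ℕ) → Set
ChromaticNumberIs q n k c = Colourable q n k c × (∀ C → Colourable q n k C → c ≤ C)

KneserHypothesis : ℕ → Set
KneserHypothesis q = ∀ k n → 1 ≤ k → q * k ≤ n →
  ChromaticNumberIs q n k (ceilDiv (n ∸ q * (k ∸ 1)) (q ∸ 1))

-- The partition V_1,...,V_m of the path's vertex set is given by a
-- class map c : Fin N → Fin m ; V_j is the class of j.
Class : {N m : ℕ} → (Fin N → Fin m) → Fin m → Subset N
Class c j = tabulate (λ x → ⌊ c x ≟ j ⌋)

Union : {r N : ℕ} → (Fin r → Subset N) → Subset N
Union S = ⋃ (List.tabulate S)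

GoodFamily : (q N m : ℕ) → (Fin N → Fin m) → (Fin q → Subset N) → Set
GoodFamily q N m c S =
  (∀ i → Stable q (S i)) ×
  PairwiseDisjoint S ×
  (∀ j → ∣ Class c j ∩ ∁ (Union S) ∣ ≤ q ∸ 1) ×
  (∀ i j → floorDiv (∣ Class c j ∣ + 1) q ∸ 1 ≤ ∣ S i ∩ Class c j ∣)

Balanced : {q N : ℕ} → (Fin q → Subset N) → Set
Balanced S = ∀ i j → ∣ S i ∣ ≤ suc ∣ S j ∣

ClassesAtLeast : (q : ℕ) {N m : ℕ} → (Fin N → Fin m) → Set
ClassesAtLeast q {N} {m} c = ∀ j → q ∸ 1 ≤ ∣ Class c j ∣

{-# OPTIONS --safe #-}
module Submission where

-- First part. Prepend to each class a block of fewer than q vertices so that its size becomes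
-- q t_j + q - 1. With k = Σ t_j the chromatic number is m + 2, so the following colouring with
-- m + 1 colours is not proper: colour a k-set F by some j with |F ∩ V_j| > t_j, or by 0 if there
-- is none. A monochromatic hyperedge must have colour 0 and hence splits every class exactly.
-- A q-stable set meets a block in at most one vertex, so removing the blocks costs at most one.
--
-- Second part. A 2-stable set is a path in which h-stable sets are 2h-stable in the big path, so
-- by doubling it suffices to treat q = 2, with exactly one vertex left out of each class. If all
-- classes have odd size 2 t_j + 1, label a sign vector by the first class in which one sign occurs
-- more than t_j times, or else by the length of its longest alternating subsequence. Without a
-- solution these are n - 1 antipodal labels on n coordinates, contradicting Tucker's lemma. Even
-- classes receive one additional vertex each; taken in adjacent pairs, these can be charged to
-- different sets, which keeps the sets balanced.

open import Defs
open import Data.Nat using (ℕ; zero; suc; _+_; _*_; _∸_; _^_; _≤_; _<_; z≤n; s≤s; ∣_-_∣; _/_; _≤?_; _<?_) renaming (_≟_ to _≟ⁿ_)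
open import Data.Nat.Properties hiding (_≟_; _≤?_; _<?_)
open import Data.Nat.DivMod using (m<n*o⇒m/o<n; m*n/n≡m)
open import Data.Nat.Tactic.RingSolver using (solve-∀)
open import Data.Bool using (Bool; true; false; not; _∧_; _∨_; _xor_; if_then_else_)
open import Data.Bool.Properties using (xor-assoc; xor-comm; xor-same; xor-identityʳ; xor-∧-commutativeRing; not-involutive; ∨-comm; ∧-zeroʳ)
open import Data.Fin using (Fin; zero; suc; toℕ; _↑ˡ_; _↑ʳ_; splitAt; combine; remQuot)
open import Data.Fin.Properties as Finₚ using (_≟_; all?; any?; ↑ˡ-injective; ↑ʳ-injective; splitAt-↑ˡ; splitAt-↑ʳ; toℕ-↑ʳ; remQuot-combine; combine-remQuot)
open import Data.Fin.Subset using (Subset; _∈_; _∉_; _⊆_; _∩_; _∪_; ∁; ∣_∣; Empty; ⊤) renaming (⊥ to ∅)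
open import Data.Fin.Subset.Properties using (_∈?_; ∉⊥; ∣⊥∣≡0; ∣⊤∣≡n; ∣p∣≤∣x∷p∣; p⊆q⇒∣p∣≤∣q∣; ⊆-antisym; x∈∁p⇒x∉p; x∉p⇒x∈∁p; x∈p∩q⁺; x∈p∩q⁻; x∈p∪q⁺; x∈p∪q⁻; ∩-identityˡ; ∩-zeroˡ; nonempty?; anySubset?)
open import Data.List using ([]; _∷_; allFin)
open import Data.List.Membership.Propositional using () renaming (_∈_ to _∈ᴸ_)
open import Data.List.Membership.Propositional.Properties using (∈-allFin)
open import Data.List.Relation.Unary.Any using (here; there)
open import Data.Maybe using (Maybe; just; nothing; fromMaybe) renaming (map to mapᴹ)
open import Data.Vec using (Vec; []; _∷_; lookup; tabulate; replicate; map; here; there; _[_]≔_)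
open import Data.Vec.Functional using () renaming (_∷_ to _◂_)
open import Data.Vec.Properties using (lookup-replicate; lookup∘tabulate; lookup∘updateAt; lookup∘updateAt′)
open import Data.Product using (Σ; ∃; _×_; _,_; proj₁; proj₂)
open import Data.Sum using (_⊎_; inj₁; inj₂)
open import Data.Empty using (⊥; ⊥-elim)
open import Function using (_∘_)
open import Relation.Nullary using (¬_; Dec; yes; no; ¬?)
open import Relation.Nullary.Decidable using (⌊_⌋; _×-dec_; _→-dec_; map′)
open import Relation.Binary.PropositionalEquality
open import Algebra.Bundles using (module CommutativeRing)
open import Algebra.Properties.CommutativeMonoid.Sum +-0-commutativeMonoid using (sum; sum-cong-≗; ∑-distrib-+)
open import Algebra.Properties.CommutativeSemigroup (CommutativeRing.+-commutativeSemigroup xor-∧-commutativeRing) using () renaming (interchange to xor-interchange)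

-- Tucker's lemma for the barycentric subdivision of the cross-polytope

-- Tucker's lemma comes from its stronger form by Fan: for an antipodal labelling without
-- complementary edges, the number of facets whose labels alternate in sign, beginning with `true`,
-- is odd. Only a parity is needed, so cochains with values in `Bool` and `_xor_` as addition
-- suffice, without orientations. A vector in `Vec Sign n` has two roles: it is a face of the
-- cross-polytope, and it is the vertex of the barycentric subdivision inside that face. With `m` in
-- place of `n` it is a face of the label complex. The zero vector is the empty face and hence no
-- vertex, so all conditions on labels exempt it. Topology and the chromatic number only refute the
-- absence of a solution; a finite search turns the refutation into a witness. Repeated halving
-- could accumulate rounding errors. The sizes are therefore compared with one fixed target instead
-- of with each other, by strict inequalities between integers: when such an inequality is doubled,
-- its slack of one becomes two, which pays for the rounding and leaves the inequality strict.

Sign : Set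
Sign = Maybe Bool

neg : ∀ {n} → Vec Sign n → Vec Sign n
neg = map (mapᴹ not)

lead : ∀ {n} → Vec Sign n → Maybe Bool
lead []            = nothing
lead (nothing ∷ x) = lead x
lead (just s ∷ x)  = just s

NonZero : ∀ {n} → Vec Sign n → Set
NonZero x = ∃ λ s → lead x ≡ just s

infix 4 _≼_
data _≼_ : ∀ {n} → Vec Sign n → Vec Sign n → Set where
  []   : [] ≼ []
  skip : ∀ {n b} {x y : Vec Sign n} → x ≼ y → nothing ∷ x ≼ b ∷ y
  keep : ∀ {n s} {x y : Vec Sign n} → x ≼ y → just s ∷ x ≼ just s ∷ y

≼-refl : ∀ {n} (x : Vec Sign n) → x ≼ x
≼-refl []            = []
≼-refl (nothing ∷ x) = skip (≼-refl x)
≼-refl (just s ∷ x)  = keep (≼-refl x)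

≼-trans : ∀ {n} {x y z : Vec Sign n} → x ≼ y → y ≼ z → x ≼ z
≼-trans []       []       = []
≼-trans (skip p) (skip q) = skip (≼-trans p q)
≼-trans (skip p) (keep q) = skip (≼-trans p q)
≼-trans (keep p) (keep q) = keep (≼-trans p q)

xor-cancelˡ : ∀ a b → a xor (a xor b) ≡ b
xor-cancelˡ false b = refl
xor-cancelˡ true  b = not-involutive b

-- The simplicial coboundary mod 2: the faces of x arise by deleting one nonzero entry.
δ : ∀ {n} → (Vec Sign n → Bool) → Vec Sign n → Bool
δ h []            = false
δ h (nothing ∷ x) = δ (h ∘ (nothing ∷_)) x
δ h (just s ∷ x)  = h (nothing ∷ x) xor δ (h ∘ (just s ∷_)) x

-- A term of the sum deletes a nonzero entry, so `NonZero x` can be offered for each term. This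
-- makes the conditions on labels available under `δ`.
δ-cong : ∀ {n} {g h : Vec Sign n → Bool} x →
         (∀ y → y ≼ x → NonZero x → g y ≡ h y) → δ g x ≡ δ h x
δ-cong []            e = refl
δ-cong (nothing ∷ x) e = δ-cong x λ y p nz → e (nothing ∷ y) (skip p) nz
δ-cong (just s ∷ x)  e = cong₂ _xor_ (e (nothing ∷ x) (skip (≼-refl x)) (s , refl))
                                     (δ-cong x λ y p _ → e (just s ∷ y) (keep p) (s , refl))

δ-xor : ∀ {n} (g h : Vec Sign n → Bool) x → δ (λ y → g y xor h y) x ≡ δ g x xor δ h x
δ-xor g h []            = refl
δ-xor g h (nothing ∷ x) = δ-xor _ _ x
δ-xor g h (just s ∷ x)  =
  trans (cong ((g (nothing ∷ x) xor h (nothing ∷ x)) xor_) (δ-xor (g ∘ (just s ∷_)) (h ∘ (just s ∷_)) x))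
        (xor-interchange (g (nothing ∷ x)) (h (nothing ∷ x)) (δ (g ∘ (just s ∷_)) x) (δ (h ∘ (just s ∷_)) x))

δ-false : ∀ {n} (x : Vec Sign n) → δ (λ _ → false) x ≡ false
δ-false []            = refl
δ-false (nothing ∷ x) = δ-false x
δ-false (just s ∷ x)  = δ-false x

δ-δ : ∀ {n} (h : Vec Sign n → Bool) x → δ (δ h) x ≡ false
δ-δ h []            = refl
δ-δ h (nothing ∷ x) = δ-δ _ x
δ-δ h (just s ∷ x)  = begin
  a xor δ (λ y → h (nothing ∷ y) xor δ (h ∘ (just s ∷_)) y) x  ≡⟨ cong (a xor_) (δ-xor _ _ x) ⟩
  a xor (a xor δ (δ (h ∘ (just s ∷_))) x)                      ≡⟨ xor-cancelˡ a _ ⟩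
  δ (δ (h ∘ (just s ∷_))) x                                    ≡⟨ δ-δ _ x ⟩
  false                                                        ∎
  where
  open ≡-Reasoning
  a = δ (h ∘ (nothing ∷_)) x

δ-zero : ∀ {n} (h : Vec Sign n → Bool) → δ h (replicate n nothing) ≡ false
δ-zero {zero}  h = refl
δ-zero {suc n} h = δ-zero (h ∘ (nothing ∷_))

-- The indicator of the faces whose signs alternate in the order of the indices. The empty face
-- counts for both first signs, which starts the induction on dimension.
alternating : ∀ {n} → Bool → Vec Sign n → Bool
alternating s     []               = true
alternating s     (nothing ∷ w)    = alternating s w
alternating true  (just true ∷ w)  = alternating false w
alternating true  (just false ∷ w) = false
alternating false (just true ∷ w)  = false
alternating false (just false ∷ w) = alternating true w

-- Deleting one entry of an alternating vector keeps it alternating with first sign s only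
-- for the first or the last entry; a vector with one repetition is repaired in two ways.
δ-alternating : ∀ {n} s (w : Vec Sign n) →
                δ (alternating s) w ≡ alternating true w xor alternating false w
δ-alternating s     []               = refl
δ-alternating s     (nothing ∷ w)    = δ-alternating s w
δ-alternating true  (just true ∷ w)  =
  trans (cong (alternating true w xor_) (δ-alternating false w))
        (trans (xor-cancelˡ (alternating true w) _) (sym (xor-identityʳ _)))
δ-alternating true  (just false ∷ w) =
  trans (cong (alternating true w xor_) (δ-false w)) (xor-identityʳ _)
δ-alternating false (just true ∷ w)  = cong (alternating false w xor_) (δ-false w)
δ-alternating false (just false ∷ w) =
  trans (cong (alternating false w xor_) (trans (δ-alternating true w) (xor-comm (alternating true w) _)))
        (xor-cancelˡ (alternating false w) _)

-- The label complex and the chain map induced by a labelling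

Label : ℕ → Set
Label m = Bool × Fin m

-- A face of the label complex is a vector in Vec Sign m, and act l g w is the value of the
-- cochain g on the join of w with the vertex l (zero if the join is degenerate).
act : ∀ {m} → Label m → (Vec Sign m → Bool) → Vec Sign m → Bool
act (s , zero)  g (nothing ∷ w) = g (just s ∷ w)
act (s , zero)  g (just _ ∷ w)  = false
act (s , suc i) g (a ∷ w)       = act (s , i) (g ∘ (a ∷_)) w

act-cong : ∀ {m} s i {g h : Vec Sign m → Bool} w →
           (lookup w i ≡ nothing → g (w [ i ]≔ just s) ≡ h (w [ i ]≔ just s)) →
           act (s , i) g w ≡ act (s , i) h w
act-cong s zero    (nothing ∷ w) e = e refl
act-cong s zero    (just _ ∷ w)  e = refl
act-cong s (suc i) (a ∷ w)       e = act-cong s i w e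

act-xor : ∀ {m} (l : Label m) (g h : Vec Sign m → Bool) w →
          act l (λ v → g v xor h v) w ≡ act l g w xor act l h w
act-xor (s , zero)  g h (nothing ∷ w) = refl
act-xor (s , zero)  g h (just _ ∷ w)  = refl
act-xor (s , suc i) g h (a ∷ w)       = act-xor (s , i) _ _ w

-- Dual form of the boundary of a cone: omit the apex, or omit a vertex of the base. If `w` already
-- contains the apex, the left side is zero and the terms on the right cancel. If `w` contained the
-- opposite label, deleting it and inserting the apex would leave an uncancelled term.
act-δ : ∀ {m} s i (g : Vec Sign m → Bool) w → lookup w i ≢ just (not s) →
        act (s , i) (δ g) w ≡ g w xor δ (act (s , i) g) w
act-δ s zero g (nothing ∷ w) _ = refl
act-δ s zero g (just r ∷ w) r≢ with s | r
... | true  | true  = sym (trans (cong (λ b → g (just true ∷ w) xor (g (just true ∷ w) xor b)) (δ-false w))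
                              (xor-cancelˡ (g (just true ∷ w)) false))
... | true  | false = ⊥-elim (r≢ refl)
... | false | true  = ⊥-elim (r≢ refl)
... | false | false = sym (trans (cong (λ b → g (just false ∷ w) xor (g (just false ∷ w) xor b)) (δ-false w))
                              (xor-cancelˡ (g (just false ∷ w)) false))
act-δ s (suc i) g (nothing ∷ w) ne = act-δ s i _ w ne
act-δ s (suc i) g (just r ∷ w) ne = begin
  act (s , i) (λ v → g (nothing ∷ v) xor δ (g ∘ (just r ∷_)) v) w
    ≡⟨ act-xor (s , i) _ _ w ⟩
  a xor act (s , i) (δ (g ∘ (just r ∷_))) w
    ≡⟨ cong (a xor_) (act-δ s i _ w ne) ⟩
  a xor (b xor d)
    ≡⟨ xor-assoc a b d ⟨
  (a xor b) xor d
    ≡⟨ cong (_xor d) (xor-comm a b) ⟩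
  (b xor a) xor d
    ≡⟨ xor-assoc b a d ⟩
  b xor (a xor d) ∎
  where
  open ≡-Reasoning
  a = act (s , i) (g ∘ (nothing ∷_)) w
  b = g (just r ∷ w)
  d = δ (act (s , i) (g ∘ (just r ∷_))) w

-- chains lab k x g evaluates g on the image under lab of the sum of all chains
-- x₁ ≺ … ≺ x_k = x in which consecutive vectors differ in one coordinate.
chains : ∀ {n m} → (Vec Sign n → Label m) → ℕ → Vec Sign n → (Vec Sign m → Bool) → Bool
chains lab zero    x g = g (replicate _ nothing)
chains lab (suc k) x g = δ (λ y → chains lab k y (act (lab x) g)) x

-- `chains` evaluates a cochain only on faces whose entries are labels of vectors below `x`.
-- Recording their origin lets `NonComplementary` rule out opposite labels in the cone formula.
Realised : ∀ {n m} → (Vec Sign n → Label m) → Vec Sign n → Vec Sign m → Set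
Realised lab x w = ∀ s i → lookup w i ≡ just s → ∃ λ y → NonZero y × y ≼ x × lab y ≡ (s , i)

chains-cong : ∀ {n m} (lab : Vec Sign n → Label m) k x {g h : Vec Sign m → Bool} →
              (∀ w → Realised lab x w → g w ≡ h w) → chains lab k x g ≡ chains lab k x h
chains-cong lab zero x e = e _ λ s i eq → case-nothing (trans (sym (lookup-replicate i nothing)) eq)
  where
  case-nothing : ∀ {s : Bool} {A : Set} → nothing ≡ just s → A
  case-nothing ()
chains-cong {m = m} lab (suc k) x e = δ-cong x λ y y≼x nz → chains-cong lab k y λ w rw →
  let (s , i) = lab x in
  act-cong s i w λ wi → e (w [ i ]≔ just s) (extend y y≼x nz w rw)
  where
  extend : ∀ y → y ≼ x → NonZero x → ∀ w → Realised lab y w →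
           Realised lab x (w [ proj₂ (lab x) ]≔ just (proj₁ (lab x)))
  extend y y≼x nz w rw s j eq with j ≟ proj₂ (lab x)
  ... | yes refl = x , nz , ≼-refl x , cong (_, j) (just-inj (trans (sym (lookup∘updateAt j w)) eq))
    where
    just-inj : ∀ {a b : Bool} → just a ≡ just b → a ≡ b
    just-inj refl = refl
  ... | no j≢ = let (z , nz′ , z≼y , lz) = rw s j (trans (sym (lookup∘updateAt′ j _ j≢ w)) eq)
                in z , nz′ , ≼-trans z≼y y≼x , lz

chains-xor : ∀ {n m} (lab : Vec Sign n → Label m) k x (g h : Vec Sign m → Bool) →
             chains lab k x (λ w → g w xor h w) ≡ chains lab k x g xor chains lab k x h
chains-xor lab zero    x g h = refl
chains-xor lab (suc k) x g h = trans
  (δ-cong x λ y _ _ → trans (chains-cong lab k y λ w _ → act-xor (lab x) g h w) (chains-xor lab k y _ _))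
  (δ-xor _ _ x)

-- Comparable nonzero vectors are the edges of the barycentric subdivision.
NonComplementary : ∀ {n m} → (Vec Sign n → Label m) → Set
NonComplementary lab = ∀ x y s i → NonZero x → x ≼ y → lab x ≡ (s , i) → lab y ≡ (not s , i) → ⊥

-- Subdivision followed by labelling is a chain map. The cone formula with apex `lab x` splits off
-- the faces that omit the top vector `x`. The faces that omit a lower vector sum to zero: by
-- induction they form a double coboundary.
chains-δ : ∀ {n m} (lab : Vec Sign n → Label m) → NonComplementary lab →
           ∀ k x (g : Vec Sign m → Bool) →
           chains lab (suc k) x (δ g) ≡ δ (λ y → chains lab k y g) x
chains-δ lab nc k x g = trans
  (δ-cong x λ y y≼x nz → trans (chains-cong lab k y λ w rw → act-δ s i g w (compatible y y≼x w rw))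
                               (chains-xor lab k y g _))
  (trans (δ-xor _ _ x)
  (trans (cong (δ (λ y → chains lab k y g) x xor_) (vanish k))
         (xor-identityʳ _)))
  where
  s = proj₁ (lab x)
  i = proj₂ (lab x)
  compatible : ∀ y → y ≼ x → ∀ w → Realised lab y w → lookup w i ≢ just (not s)
  compatible y y≼x w rw eq = let (z , nz , z≼y , lz) = rw (not s) i eq in
    nc z x (not s) i nz (≼-trans z≼y y≼x) lz (cong (_, i) (sym (not-involutive s)))
  vanish : ∀ k → δ (λ y → chains lab k y (δ (act (lab x) g))) x ≡ false
  vanish zero    = trans (δ-cong x λ _ _ _ → δ-zero (act (lab x) g)) (δ-false x)
  vanish (suc k) = trans (δ-cong x λ y _ _ → chains-δ lab nc k y _) (δ-δ _ x)

-- Antipodality, hemispheres and parity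

lead-neg : ∀ {n} (x : Vec Sign n) → lead (neg x) ≡ mapᴹ not (lead x)
lead-neg []            = refl
lead-neg (nothing ∷ x) = lead-neg x
lead-neg (just s ∷ x)  = refl

δ-neg : ∀ {n} (h : Vec Sign n → Bool) x → δ h (neg x) ≡ δ (h ∘ neg) x
δ-neg h []            = refl
δ-neg h (nothing ∷ x) = δ-neg _ x
δ-neg h (just s ∷ x)  = cong (h (nothing ∷ neg x) xor_) (δ-neg (h ∘ (just (not s) ∷_)) x)

act-neg : ∀ {m} s i (g : Vec Sign m → Bool) w → act (not s , i) g (neg w) ≡ act (s , i) (g ∘ neg) w
act-neg s zero    g (nothing ∷ w) = refl
act-neg s zero    g (just _ ∷ w)  = refl
act-neg s (suc i) g (a ∷ w)       = act-neg s i _ w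

Antipodal : ∀ {n m} → (Vec Sign n → Label m) → Set
Antipodal lab = ∀ x → NonZero x → lab (neg x) ≡ (not (proj₁ (lab x)) , proj₂ (lab x))

neg-zero : ∀ m → neg (replicate m nothing) ≡ replicate m nothing
neg-zero zero    = refl
neg-zero (suc m) = cong (nothing ∷_) (neg-zero m)

chains-neg : ∀ {n m} (lab : Vec Sign n → Label m) → Antipodal lab →
             ∀ k x (g : Vec Sign m → Bool) → chains lab k (neg x) g ≡ chains lab k x (g ∘ neg)
chains-neg {m = m} lab ap zero x g = cong g (sym (neg-zero m))
chains-neg lab ap (suc k) x g = trans (δ-neg _ x) (δ-cong x λ y _ nz → trans
  (chains-neg lab ap k y _)
  (chains-cong lab k y λ w _ → trans (cong (λ l → act l g (neg w)) (ap x nz))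
                                     (act-neg (proj₁ (lab x)) (proj₂ (lab x)) g w)))

alternating-neg : ∀ {n} s (w : Vec Sign n) → alternating s (neg w) ≡ alternating (not s) w
alternating-neg s     []               = refl
alternating-neg s     (nothing ∷ w)    = alternating-neg s w
alternating-neg true  (just true ∷ w)  = refl
alternating-neg true  (just false ∷ w) = alternating-neg false w
alternating-neg false (just true ∷ w)  = alternating-neg true w
alternating-neg false (just false ∷ w) = refl

chains-nothing : ∀ {n m} (lab : Vec Sign (suc n) → Label m) k (x : Vec Sign n) (g : Vec Sign m → Bool) →
                 chains lab k (nothing ∷ x) g ≡ chains (lab ∘ (nothing ∷_)) k x g
chains-nothing lab zero    x g = refl
chains-nothing lab (suc k) x g = δ-cong x λ y _ _ → chains-nothing lab k y _

orthants : ∀ n → (Vec Sign n → Bool) → Bool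
orthants zero    h = h []
orthants (suc n) h = orthants n (h ∘ (just true ∷_)) xor orthants n (h ∘ (just false ∷_))

orthants-cong : ∀ n {g h : Vec Sign n → Bool} → (∀ x → g x ≡ h x) → orthants n g ≡ orthants n h
orthants-cong zero    e = e []
orthants-cong (suc n) e = cong₂ _xor_ (orthants-cong n λ x → e (just true ∷ x))
                                      (orthants-cong n λ x → e (just false ∷ x))

orthants-xor : ∀ n (g h : Vec Sign n → Bool) →
               orthants n (λ x → g x xor h x) ≡ orthants n g xor orthants n h
orthants-xor zero    g h = refl
orthants-xor (suc n) g h = trans
  (cong₂ _xor_ (orthants-xor n (g ∘ (just true ∷_)) (h ∘ (just true ∷_)))
               (orthants-xor n (g ∘ (just false ∷_)) (h ∘ (just false ∷_))))
  (xor-interchange (orthants n (g ∘ (just true ∷_))) (orthants n (h ∘ (just true ∷_)))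
                   (orthants n (g ∘ (just false ∷_))) (orthants n (h ∘ (just false ∷_))))

orthants-neg : ∀ n (h : Vec Sign n → Bool) → orthants n (h ∘ neg) ≡ orthants n h
orthants-neg zero    h = refl
orthants-neg (suc n) h = trans
  (cong₂ _xor_ (orthants-neg n (h ∘ (just false ∷_))) (orthants-neg n (h ∘ (just true ∷_))))
  (xor-comm (orthants n (h ∘ (just false ∷_))) _)

orthants-false : ∀ n → orthants n (λ _ → false) ≡ false
orthants-false zero    = refl
orthants-false (suc n) = cong₂ _xor_ (orthants-false n) (orthants-false n)

-- The sphere is a cycle mod 2: a vector with exactly one zero is a face of exactly two orthants.
orthants-δ : ∀ n (h : Vec Sign n → Bool) → orthants n (δ h) ≡ false
orthants-δ zero    h = refl
orthants-δ (suc n) h = trans (cong₂ _xor_ (half true) (half false)) (xor-same (a xor false))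
  where
  a = orthants n (h ∘ (nothing ∷_))
  half : ∀ s → orthants n (δ h ∘ (just s ∷_)) ≡ a xor false
  half s = trans (orthants-xor n (h ∘ (nothing ∷_)) (δ (h ∘ (just s ∷_))))
                 (cong (a xor_) (orthants-δ n (h ∘ (just s ∷_))))

-- The sphere with n coordinates consists of two antipodal hemispheres, and the boundary of
-- a hemisphere is the sphere with n - 1 coordinates.
odd-alternating : ∀ {n m} (lab : Vec Sign n → Label m) → Antipodal lab → NonComplementary lab →
                  orthants n (λ x → chains lab n x (alternating true)) ≡ true
odd-alternating {zero} {m} lab ap nc = alternating-zero m
  where
  alternating-zero : ∀ m → alternating true (replicate m nothing) ≡ true
  alternating-zero zero    = refl
  alternating-zero (suc m) = alternating-zero m
odd-alternating {suc n} {m} lab ap nc = begin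
  north (alternating true) xor orthants n (λ y → chains lab (suc n) (just false ∷ y) (alternating true))
    ≡⟨ cong (north (alternating true) xor_) south ⟩
  north (alternating true) xor north (alternating false)
    ≡⟨ orthants-xor n _ _ ⟨
  orthants n (λ y → chains lab (suc n) (just true ∷ y) (alternating true)
                xor chains lab (suc n) (just true ∷ y) (alternating false))
    ≡⟨ orthants-cong n (λ y → trans (sym (chains-xor lab (suc n) (just true ∷ y) _ _))
                                    (chains-cong lab (suc n) (just true ∷ y) λ w _ → sym (δ-alternating true w))) ⟩
  north (δ (alternating true))
    -- Only the facets of `just true ∷ y` remain: `nothing ∷ y` on the equator, and those collected
    -- in `δ upper y`, each of which is shared by two orthants of the hemisphere.
    ≡⟨ orthants-cong n (λ y → chains-δ lab nc n (just true ∷ y) _) ⟩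
  orthants n (λ y → chains lab n (nothing ∷ y) (alternating true) xor δ upper y)
    ≡⟨ orthants-xor n _ (δ upper) ⟩
  orthants n (λ y → chains lab n (nothing ∷ y) (alternating true)) xor orthants n (δ upper)
    ≡⟨ cong₂ _xor_ (orthants-cong n (λ y → chains-nothing lab n y _)) (orthants-δ n upper) ⟩
  orthants n (λ y → chains (lab ∘ (nothing ∷_)) n y (alternating true)) xor false
    ≡⟨ xor-identityʳ _ ⟩
  orthants n (λ y → chains (lab ∘ (nothing ∷_)) n y (alternating true))
    ≡⟨ odd-alternating (lab ∘ (nothing ∷_)) (λ x → ap (nothing ∷ x))
         (λ x y s i nz x≼y → nc (nothing ∷ x) (nothing ∷ y) s i nz (skip x≼y)) ⟩
  true ∎
  where
  open ≡-Reasoning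
  north : (Vec Sign m → Bool) → Bool
  north g = orthants n (λ y → chains lab (suc n) (just true ∷ y) g)
  upper : Vec Sign n → Bool
  upper z = chains lab n (just true ∷ z) (alternating true)
  south : orthants n (λ y → chains lab (suc n) (just false ∷ y) (alternating true)) ≡ north (alternating false)
  south = trans (sym (orthants-neg n _)) (orthants-cong n λ y →
    trans (chains-neg lab ap (suc n) (just true ∷ y) (alternating true))
          (chains-cong lab (suc n) (just true ∷ y) λ w _ → alternating-neg true w))

weight : ∀ {n} → Vec Sign n → ℕ
weight []            = 0
weight (nothing ∷ w) = weight w
weight (just _ ∷ w)  = suc (weight w)

weight≤ : ∀ {n} (w : Vec Sign n) → weight w ≤ n
weight≤ []            = z≤n
weight≤ (nothing ∷ w) = ≤-trans (weight≤ w) (n≤1+n _)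
weight≤ (just _ ∷ w)  = s≤s (weight≤ w)

weight-update : ∀ {n} (w : Vec Sign n) i s → lookup w i ≡ nothing → weight (w [ i ]≔ just s) ≡ suc (weight w)
weight-update (nothing ∷ w) zero    s e = refl
weight-update (nothing ∷ w) (suc i) s e = weight-update w i s e
weight-update (just _ ∷ w)  (suc i) s e = cong suc (weight-update w i s e)

chains-weight : ∀ {n m} (lab : Vec Sign n → Label m) k x (g : Vec Sign m → Bool) →
                (∀ w → k ≤ weight w → g w ≡ false) → chains lab k x g ≡ false
chains-weight lab zero    x g e = e _ z≤n
chains-weight lab (suc k) x g e = trans
  (δ-cong x λ y _ _ → chains-weight lab k y _ λ w k≤w → trans
    (act-cong (proj₁ (lab x)) (proj₂ (lab x)) {h = λ _ → false} w λ wi →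
      e _ (subst (suc k ≤_) (sym (weight-update w _ _ wi)) (s≤s k≤w)))
    (act-false (lab x) w))
  (δ-false x)
  where
  act-false : ∀ {m} (l : Label m) w → act l (λ _ → false) w ≡ false
  act-false (s , zero)  (nothing ∷ w) = refl
  act-false (s , zero)  (just _ ∷ w)  = refl
  act-false (s , suc i) (a ∷ w)       = act-false (s , i) w

-- An alternating image of a facet has `n` distinct indices. For `m < n` there is none, and zero is
-- not odd.
tucker : ∀ {n m} (lab : Vec Sign n → Label m) → Antipodal lab → NonComplementary lab → n ≤ m
tucker {n} {m} lab ap nc with n ≤? m
... | yes n≤m = n≤m
... | no n≰m with trans (sym (odd-alternating lab ap nc)) (trans (orthants-cong n vanish) (orthants-false n))
  where
  vanish : ∀ x → chains lab n x (alternating true) ≡ false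
  vanish x = chains-weight lab n x _ λ w n≤w → ⊥-elim (n≰m (≤-trans n≤w (weight≤ w)))
... | ()

-- Finite sums, class sizes, search and stability

bit : Bool → ℕ
bit true  = 1
bit false = 0

∣∷∣ : ∀ {n} b (p : Subset n) → ∣ b ∷ p ∣ ≡ bit b + ∣ p ∣
∣∷∣ true  p = refl
∣∷∣ false p = refl

sum-0 : ∀ m → sum {m} (λ _ → 0) ≡ 0
sum-0 zero    = refl
sum-0 (suc m) = sum-0 m

sum-const : ∀ m a → sum {m} (λ _ → a) ≡ m * a
sum-const zero    a = refl
sum-const (suc m) a = cong (a +_) (sum-const m a)

sum-mono : ∀ {m} {f g : Fin m → ℕ} → (∀ i → f i ≤ g i) → sum f ≤ sum g
sum-mono {zero}  f≤g = z≤n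
sum-mono {suc m} f≤g = +-mono-≤ (f≤g zero) (sum-mono (f≤g ∘ suc))

sum-tight : ∀ {m} {f g : Fin m → ℕ} → (∀ i → f i ≤ g i) → sum g ≤ sum f → ∀ i → f i ≡ g i
sum-tight {suc m} {f} {g} f≤g g≤f zero = ≤-antisym (f≤g zero)
  (+-cancelʳ-≤ (sum (f ∘ suc)) (g zero) (f zero)
    (≤-trans (+-monoʳ-≤ (g zero) (sum-mono (f≤g ∘ suc))) g≤f))
sum-tight {suc m} {f} {g} f≤g g≤f (suc i) = sum-tight (f≤g ∘ suc)
  (+-cancelˡ-≤ (f zero) _ _ (≤-trans (+-monoˡ-≤ _ (f≤g zero)) g≤f)) i

isYes-true : ∀ {P : Set} (P? : Dec P) → ⌊ P? ⌋ ≡ true → P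
isYes-true (yes p) _ = p

isYes-false : ∀ {P : Set} (P? : Dec P) → ⌊ P? ⌋ ≡ false → ¬ P
isYes-false (no ¬p) _ = ¬p

isYes-suc : ∀ {m} (i j : Fin m) → ⌊ suc i ≟ suc j ⌋ ≡ ⌊ i ≟ j ⌋
isYes-suc i j with i ≟ j
... | yes refl = refl
... | no _     = refl

sum-indicator : ∀ {m} (i : Fin m) → sum (λ j → bit ⌊ i ≟ j ⌋) ≡ 1
sum-indicator {suc m} zero    = cong suc (sum-0 m)
sum-indicator {suc m} (suc i) = trans (sum-cong-≗ λ j → cong bit (isYes-suc i j)) (sum-indicator i)

∣∩Class∣-sum : ∀ {N m} (c : Fin N → Fin m) (A : Subset N) → sum (λ j → ∣ A ∩ Class c j ∣) ≡ ∣ A ∣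
∣∩Class∣-sum {m = m} c []          = sum-0 m
∣∩Class∣-sum         c (false ∷ A) = ∣∩Class∣-sum (c ∘ suc) A
∣∩Class∣-sum         c (true ∷ A)  = begin
  sum (λ j → ∣ ⌊ c zero ≟ j ⌋ ∷ A ∩ Class (c ∘ suc) j ∣)
    ≡⟨ sum-cong-≗ (λ j → ∣∷∣ ⌊ c zero ≟ j ⌋ (A ∩ Class (c ∘ suc) j)) ⟩
  sum (λ j → bit ⌊ c zero ≟ j ⌋ + ∣ A ∩ Class (c ∘ suc) j ∣)
    ≡⟨ ∑-distrib-+ (λ j → bit ⌊ c zero ≟ j ⌋) (λ j → ∣ A ∩ Class (c ∘ suc) j ∣) ⟩
  sum (λ j → bit ⌊ c zero ≟ j ⌋) + sum (λ j → ∣ A ∩ Class (c ∘ suc) j ∣)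
    ≡⟨ cong₂ _+_ (sum-indicator (c zero)) (∣∩Class∣-sum (c ∘ suc) A) ⟩
  suc ∣ A ∣ ∎
  where open ≡-Reasoning

∣Class∣-sum : ∀ {N m} (c : Fin N → Fin m) → sum (λ j → ∣ Class c j ∣) ≡ N
∣Class∣-sum {N} c = trans (sum-cong-≗ λ j → cong ∣_∣ (sym (∩-identityˡ (Class c j))))
                          (trans (∣∩Class∣-sum c ⊤) (∣⊤∣≡n N))

-- Halvings and exact splittings are decidable properties of finitely many candidates, so refuting
-- their absence is enough to obtain one.
Searchable : Set → Set₁
Searchable A = ∀ {P : A → Set} → (∀ a → Dec (P a)) → Dec (∃ P)

search-Vec : ∀ {A} → Searchable A → ∀ n → Searchable (Vec A n)
search-Vec sA zero    P? = map′ (λ p → [] , p) (λ { ([] , p) → p }) (P? [])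
search-Vec sA (suc n) P? = map′ (λ { (a , v , p) → a ∷ v , p }) (λ { (a ∷ v , p) → a , v , p })
                                (sA λ a → search-Vec sA n λ v → P? (a ∷ v))

search-Sign : Searchable Sign
search-Sign P? with P? nothing | P? (just true) | P? (just false)
... | yes p | _     | _     = yes (_ , p)
... | no _  | yes p | _     = yes (_ , p)
... | no _  | no _  | yes p = yes (_ , p)
... | no ¬a | no ¬b | no ¬c = no λ { (nothing , p) → ¬a p ; (just true , p) → ¬b p ; (just false , p) → ¬c p }

Stable? : ∀ q {N} (S : Subset N) → Dec (Stable q S)
Stable? q S = all? λ x → all? λ y → (x ∈? S) →-dec ((y ∈? S) →-dec (¬? (x ≟ y) →-dec (q ≤? ∣ toℕ x - toℕ y ∣)))

Stable-tail : ∀ {q N b} {S : Subset N} → Stable q (b ∷ S) → Stable q S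
Stable-tail st x y x∈ y∈ x≢y = st (suc x) (suc y) (there x∈) (there y∈) λ { refl → x≢y refl }

Stable-false : ∀ {q N} {S : Subset N} → Stable q S → Stable q (false ∷ S)
Stable-false st (suc x) (suc y) (there x∈) (there y∈) x≢y = st x y x∈ y∈ (x≢y ∘ cong suc)

Stable2-true : ∀ {N} {S : Subset N} → Stable 2 S → (∀ x → x ∈ S → 1 ≤ toℕ x) → Stable 2 (true ∷ S)
Stable2-true st pos zero    zero    here       here       x≢y = ⊥-elim (x≢y refl)
Stable2-true st pos zero    (suc y) here       (there y∈) x≢y = s≤s (pos y y∈)
Stable2-true st pos (suc x) zero    (there x∈) here       x≢y = s≤s (pos x x∈)
Stable2-true st pos (suc x) (suc y) (there x∈) (there y∈) x≢y = st x y x∈ y∈ (x≢y ∘ cong suc)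

-- Alternating sign vectors

is : Bool → Sign → Bool
is s     nothing  = false
is true  (just r) = r
is false (just r) = not r

mask : ∀ {n} → Bool → Vec Sign n → Subset n
mask s = map (is s)

is-neg : ∀ s a → is s (mapᴹ not a) ≡ is (not s) a
is-neg s     nothing  = refl
is-neg true  (just r) = refl
is-neg false (just r) = not-involutive r

mask-neg : ∀ {n} s (x : Vec Sign n) → mask s (neg x) ≡ mask (not s) x
mask-neg s []      = refl
mask-neg s (a ∷ x) = cong₂ _∷_ (is-neg s a) (mask-neg s x)

∣mask∩∣-mono : ∀ {n} s {x y : Vec Sign n} → x ≼ y → ∀ C → ∣ mask s x ∩ C ∣ ≤ ∣ mask s y ∩ C ∣
∣mask∩∣-mono s []                  []      = z≤n
∣mask∩∣-mono s {y = b ∷ y} (skip x≼y) (a ∷ C) = ≤-trans (∣mask∩∣-mono s x≼y C) (∣p∣≤∣x∷p∣ (is s b ∧ a) (mask s y ∩ C))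
∣mask∩∣-mono s {just r ∷ x} {just r ∷ y} (keep x≼y) (a ∷ C) =
  subst₂ _≤_ (sym (∣∷∣ (is s (just r) ∧ a) (mask s x ∩ C))) (sym (∣∷∣ (is s (just r) ∧ a) (mask s y ∩ C)))
    (+-monoʳ-≤ _ (∣mask∩∣-mono s x≼y C))

∣mask∩∣-disjoint : ∀ {n} (x : Vec Sign n) C → ∣ mask true x ∩ C ∣ + ∣ mask false x ∩ C ∣ ≤ ∣ C ∣
∣mask∩∣-disjoint []               []          = z≤n
∣mask∩∣-disjoint (nothing ∷ x)    (false ∷ C) = ∣mask∩∣-disjoint x C
∣mask∩∣-disjoint (nothing ∷ x)    (true ∷ C)  = ≤-trans (∣mask∩∣-disjoint x C) (n≤1+n _)
∣mask∩∣-disjoint (just true ∷ x)  (false ∷ C) = ∣mask∩∣-disjoint x C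
∣mask∩∣-disjoint (just true ∷ x)  (true ∷ C)  = s≤s (∣mask∩∣-disjoint x C)
∣mask∩∣-disjoint (just false ∷ x) (false ∷ C) = ∣mask∩∣-disjoint x C
∣mask∩∣-disjoint (just false ∷ x) (true ∷ C)  =
  ≤-trans (≤-reflexive (+-suc ∣ mask true x ∩ C ∣ _)) (s≤s (∣mask∩∣-disjoint x C))

∣mask∣-weight : ∀ {n} (x : Vec Sign n) → ∣ mask true x ∣ + ∣ mask false x ∣ ≡ weight x
∣mask∣-weight []               = refl
∣mask∣-weight (nothing ∷ x)    = ∣mask∣-weight x
∣mask∣-weight (just true ∷ x)  = cong suc (∣mask∣-weight x)
∣mask∣-weight (just false ∷ x) = trans (+-suc ∣ mask true x ∣ _) (cong suc (∣mask∣-weight x))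

mask-disjoint : ∀ {n} (x : Vec Sign n) → Empty (mask true x ∩ mask false x)
mask-disjoint (nothing ∷ x)    (suc i , there p) = mask-disjoint x (i , p)
mask-disjoint (just true ∷ x)  (suc i , there p) = mask-disjoint x (i , p)
mask-disjoint (just false ∷ x) (suc i , there p) = mask-disjoint x (i , p)

-- alt s x is the length of a longest alternating subsequence of x with first sign s.
alt : ∀ {n} → Bool → Vec Sign n → ℕ
alt s     []               = 0
alt s     (nothing ∷ x)    = alt s x
alt true  (just true ∷ x)  = suc (alt false x)
alt true  (just false ∷ x) = alt true x
alt false (just true ∷ x)  = alt false x
alt false (just false ∷ x) = suc (alt true x)

alt-neg : ∀ {n} s (x : Vec Sign n) → alt s (neg x) ≡ alt (not s) x
alt-neg s     []               = refl
alt-neg s     (nothing ∷ x)    = alt-neg s x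
alt-neg true  (just true ∷ x)  = alt-neg true x
alt-neg true  (just false ∷ x) = cong suc (alt-neg false x)
alt-neg false (just true ∷ x)  = cong suc (alt-neg true x)
alt-neg false (just false ∷ x) = alt-neg false x

alt≤weight : ∀ {n} s (x : Vec Sign n) → alt s x ≤ weight x
alt≤weight s     []               = z≤n
alt≤weight s     (nothing ∷ x)    = alt≤weight s x
alt≤weight true  (just true ∷ x)  = s≤s (alt≤weight false x)
alt≤weight true  (just false ∷ x) = m≤n⇒m≤1+n (alt≤weight true x)
alt≤weight false (just true ∷ x)  = m≤n⇒m≤1+n (alt≤weight false x)
alt≤weight false (just false ∷ x) = s≤s (alt≤weight true x)

alt≤suc-alt-not : ∀ {n} s (x : Vec Sign n) → alt s x ≤ suc (alt (not s) x)
alt≤suc-alt-not s     []               = z≤n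
alt≤suc-alt-not s     (nothing ∷ x)    = alt≤suc-alt-not s x
alt≤suc-alt-not true  (just true ∷ x)  = ≤-refl
alt≤suc-alt-not true  (just false ∷ x) = ≤-trans (n≤1+n _) (n≤1+n _)
alt≤suc-alt-not false (just true ∷ x)  = ≤-trans (n≤1+n _) (n≤1+n _)
alt≤suc-alt-not false (just false ∷ x) = ≤-refl

alt-mono : ∀ {n} s {x y : Vec Sign n} → x ≼ y → alt s x ≤ alt s y
alt-mono s     []                         = z≤n
alt-mono s     (skip {b = nothing} x≼y)   = alt-mono s x≼y
alt-mono true  {nothing ∷ x} (skip {b = just true} x≼y)  = ≤-trans (alt≤suc-alt-not true x) (s≤s (alt-mono false x≼y))
alt-mono true  (skip {b = just false} x≼y) = alt-mono true x≼y
alt-mono false (skip {b = just true} x≼y)  = alt-mono false x≼y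
alt-mono false {nothing ∷ x} (skip {b = just false} x≼y) = ≤-trans (alt≤suc-alt-not false x) (s≤s (alt-mono true x≼y))
alt-mono true  (keep {s = true} x≼y)      = s≤s (alt-mono false x≼y)
alt-mono true  (keep {s = false} x≼y)     = alt-mono true x≼y
alt-mono false (keep {s = true} x≼y)      = alt-mono false x≼y
alt-mono false (keep {s = false} x≼y)     = s≤s (alt-mono true x≼y)

alt-lead : ∀ {n} s (x : Vec Sign n) → lead x ≡ just s → alt s x ≡ suc (alt (not s) x)
alt-lead s     (nothing ∷ x)    e    = alt-lead s x e
alt-lead true  (just .true ∷ x)  refl = refl
alt-lead false (just .false ∷ x) refl = refl

tight-first : ∀ {n} s (x : Vec Sign n) → weight x ≤ alt (not s) x → ∀ i → i ∈ mask s x → 1 ≤ toℕ i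
tight-first true  (just .true ∷ x)  w zero here = ⊥-elim (<-irrefl refl (≤-trans w (alt≤weight false x)))
tight-first false (just true ∷ x)  w zero ()
tight-first false (just false ∷ x) w zero here = ⊥-elim (<-irrefl refl (≤-trans w (alt≤weight true x)))
tight-first s     x w (suc i) _ = s≤s z≤n

-- The hypothesis forces all nonzero entries into one alternating sequence. Two equal signs then
-- have an opposite sign between them and cannot be adjacent.
tight-Stable : ∀ {n} s (x : Vec Sign n) → weight x ≤ alt s x → ∀ r → Stable 2 (mask r x)
tight-Stable s     []               w r     = λ ()
tight-Stable s     (nothing ∷ x)    w r     = Stable-false (tight-Stable s x w r)
tight-Stable true  (just true ∷ x)  (s≤s w) true  = Stable2-true (tight-Stable false x w true) (tight-first true x w)
tight-Stable true  (just true ∷ x)  (s≤s w) false = Stable-false (tight-Stable false x w false)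
tight-Stable true  (just false ∷ x) w r     = ⊥-elim (<-irrefl refl (≤-trans w (alt≤weight true x)))
tight-Stable false (just true ∷ x)  w r     = ⊥-elim (<-irrefl refl (≤-trans w (alt≤weight false x)))
tight-Stable false (just false ∷ x) (s≤s w) true  = Stable-false (tight-Stable true x w true)
tight-Stable false (just false ∷ x) (s≤s w) false = Stable2-true (tight-Stable true x w false) (tight-first false x w)

first : ∀ {m} → (Fin m → Bool) → Maybe (Fin m)
first {zero}  b = nothing
first {suc m} b = if b zero then just zero else mapᴹ suc (first (b ∘ suc))

first-cong : ∀ {m} {a b : Fin m → Bool} → (∀ i → a i ≡ b i) → first a ≡ first b
first-cong {zero}  e = refl
first-cong {suc m} {a} {b} e rewrite e zero | first-cong (e ∘ suc) = refl

first-just : ∀ {m} (b : Fin m → Bool) {i} → first b ≡ just i → b i ≡ true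
first-just {suc m} b e with b zero in b0
first-just {suc m} b refl | true = b0
first-just {suc m} b e | false with first (b ∘ suc) in eq
first-just {suc m} b refl | false | just i = first-just (b ∘ suc) eq

first-nothing : ∀ {m} (b : Fin m → Bool) → first b ≡ nothing → ∀ i → b i ≡ false
first-nothing {suc m} b e i with b zero in b0 | first (b ∘ suc) in eq
first-nothing {suc m} b e zero    | false | nothing = b0
first-nothing {suc m} b e (suc i) | false | nothing = first-nothing (b ∘ suc) eq i

-- Truncation makes the labelling total. Wherever the label of a nonzero vector is compared,
-- `light-alt` places the argument in the range on which nothing is cut off.
clip : ∀ L → ℕ → Fin (suc L)
clip zero    _       = zero
clip (suc L) zero    = zero
clip (suc L) (suc a) = suc (clip L a)

toℕ-clip : ∀ L a → a < suc L → toℕ (clip L a) ≡ a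
toℕ-clip zero    zero    _         = refl
toℕ-clip zero    (suc a) (s≤s ())
toℕ-clip (suc L) zero    _         = refl
toℕ-clip (suc L) (suc a) (s≤s a<)  = cong suc (toℕ-clip L a a<)

-- Halving a path all of whose classes have odd size

Halving : ∀ {N m} → (Fin N → Fin m) → (Fin m → ℕ) → Vec Sign N → Set
Halving c t x = (Stable 2 (mask true x) × Stable 2 (mask false x)) ×
  (∀ j → ∣ mask true x ∩ Class c j ∣ ≡ t j × ∣ mask false x ∩ Class c j ∣ ≡ t j)

Halving? : ∀ {N m} (c : Fin N → Fin m) t x → Dec (Halving c t x)
Halving? c t x = (Stable? 2 (mask true x) ×-dec Stable? 2 (mask false x)) ×-dec
  all? λ j → (∣ mask true x ∩ Class c j ∣ ≟ⁿ t j) ×-dec (∣ mask false x ∩ Class c j ∣ ≟ⁿ t j)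

module OddClasses {N m : ℕ} (c : Fin N → Fin m) (t : Fin m → ℕ) (odd : ∀ j → ∣ Class c j ∣ ≡ suc (t j + t j)) where

  private
    k : ℕ
    k = sum t

    num : Bool → Fin m → Vec Sign N → ℕ
    num s j x = ∣ mask s x ∩ Class c j ∣

    length≡ : N ≡ m + (k + k)
    length≡ = begin
      N                               ≡⟨ ∣Class∣-sum c ⟨
      sum (λ j → ∣ Class c j ∣)       ≡⟨ sum-cong-≗ odd ⟩
      sum (λ j → 1 + (t j + t j))     ≡⟨ ∑-distrib-+ (λ _ → 1) (λ j → t j + t j) ⟩
      sum {m} (λ _ → 1) + sum (λ j → t j + t j)
        ≡⟨ cong₂ _+_ (trans (sum-const m 1) (*-identityʳ m)) (∑-distrib-+ t t) ⟩
      m + (k + k)                     ∎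
      where open ≡-Reasoning

    -- The class bounds give weight at most `k + k`, so an alternating subsequence of that length
    -- uses every nonzero entry and forces equality in every class bound.
    tight-Halving : ∀ s x → (∀ r j → num r j x ≤ t j) → k + k ≤ alt s x → Halving c t x
    tight-Halving s x num≤ 2k≤alt = (st true , st false) , λ j →
        sum-tight (num≤ true) k≤₊ j , sum-tight (num≤ false) k≤₋ j
      where
      ∣mask∣≤ : ∀ r → ∣ mask r x ∣ ≤ k
      ∣mask∣≤ r = subst (_≤ k) (∣∩Class∣-sum c (mask r x)) (sum-mono (num≤ r))
      weight≤2k : weight x ≤ k + k
      weight≤2k = subst (_≤ k + k) (∣mask∣-weight x) (+-mono-≤ (∣mask∣≤ true) (∣mask∣≤ false))
      st : ∀ r → Stable 2 (mask r x)
      st = tight-Stable s x (≤-trans weight≤2k 2k≤alt)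
      2k≤ : k + k ≤ ∣ mask true x ∣ + ∣ mask false x ∣
      2k≤ = subst (k + k ≤_) (sym (∣mask∣-weight x)) (≤-trans 2k≤alt (alt≤weight s x))
      k≤₊ : k ≤ sum (λ j → num true j x)
      k≤₊ = subst (k ≤_) (sym (∣∩Class∣-sum c (mask true x)))
              (+-cancelʳ-≤ k _ _ (≤-trans 2k≤ (+-monoʳ-≤ _ (∣mask∣≤ false))))
      k≤₋ : k ≤ sum (λ j → num false j x)
      k≤₋ = subst (k ≤_) (sym (∣∩Class∣-sum c (mask false x)))
              (+-cancelˡ-≤ k _ _ (≤-trans 2k≤ (+-monoˡ-≤ _ (∣mask∣≤ true))))

  module NoHalving (k′ : ℕ) (k≡ : k ≡ suc k′) (none : ∀ x → ¬ Halving c t x) where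

    private
      L : ℕ
      -- Light vectors receive `suc L = 2k - 1` indices. Together with one index per class these are
      -- `m + 2k - 1 = N - 1`, one too few for Tucker's lemma.
      L = k′ + k′

      2k≡ : k + k ≡ suc (suc L)
      2k≡ = trans (cong₂ _+_ k≡ k≡) (cong suc (+-suc k′ k′))

      over : Bool → Fin m → Vec Sign N → Bool
      over s j x = ⌊ t j <? num s j x ⌋

      heavy : Vec Sign N → Maybe (Fin m)
      heavy x = first λ j → over true j x ∨ over false j x

      sgn : Vec Sign N → Bool
      -- The default concerns the zero vector only, which no condition on labels mentions.
      sgn x = fromMaybe true (lead x)

      label : Vec Sign N → Maybe (Fin m) → Label (suc L + m)
      label x (just j) = over true j x , suc L ↑ʳ j
      -- Starting with the wrong sign costs exactly the leading entry, so this is the maximal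
      -- alternating length minus one, and the indices begin at zero.
      label x nothing  = sgn x , clip L (alt (not (sgn x)) x) ↑ˡ m

      lab : Vec Sign N → Label (suc L + m)
      lab x = label x (heavy x)

      over⇒ : ∀ s j x → over s j x ≡ true → t j < num s j x
      over⇒ s j x = isYes-true (t j <? num s j x)

      ¬over⇒ : ∀ s j x → over s j x ≡ false → num s j x ≤ t j
      ¬over⇒ s j x e = ≮⇒≥ (isYes-false (t j <? num s j x) e)

      over-neg : ∀ s j x → over s j (neg x) ≡ over (not s) j x
      over-neg s j x = cong (λ A → ⌊ t j <? ∣ A ∩ Class c j ∣ ⌋) (mask-neg s x)

      not-both : ∀ j x → t j < num true j x → t j < num false j x → ⊥
      not-both j x p q = <-irrefl (cong suc (+-suc (t j) (t j)))
        (s≤s (≤-trans (+-mono-≤ p q) (≤-trans (∣mask∩∣-disjoint x (Class c j)) (≤-reflexive (odd j)))))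

      heavy-neg : ∀ x → heavy (neg x) ≡ heavy x
      heavy-neg x = first-cong λ j →
        trans (cong₂ _∨_ (over-neg true j x) (over-neg false j x)) (∨-comm (over false j x) _)

      light-alt : ∀ x s → heavy x ≡ nothing → lead x ≡ just s → alt (not s) x < suc L
      light-alt x s hv ld = ≰⇒> λ L<alt → none x (tight-Halving s x num≤
          (≤-trans (≤-reflexive 2k≡) (≤-trans (s≤s L<alt) (≤-reflexive (sym (alt-lead s x ld))))))
        where
        num≤ : ∀ r j → num r j x ≤ t j
        num≤ r j with over true j x in e₁ | over false j x in e₂ | first-nothing _ hv j
        num≤ true  j | false | false | _ = ¬over⇒ true j x e₁
        num≤ false j | false | false | _ = ¬over⇒ false j x e₂

      is-heavy : ∀ x j → heavy x ≡ just j → over true j x ∨ over false j x ≡ true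
      is-heavy x j = first-just _

      over-true : ∀ x j → heavy x ≡ just j → over false j x ≡ not (over true j x)
      over-true x j hv with over true j x in e₁ | over false j x in e₂ | is-heavy x j hv
      ... | true  | true  | _ = ⊥-elim (not-both j x (over⇒ true j x e₁) (over⇒ false j x e₂))
      ... | true  | false | _ = refl
      ... | false | true  | _ = refl

      antipodal : Antipodal lab
      antipodal x (s , ld) rewrite heavy-neg x with heavy x in hv
      ... | just j  = cong (_, suc L ↑ʳ j) (trans (over-neg true j x) (over-true x j hv))
      ... | nothing rewrite lead-neg x | ld =
        cong (λ a → not s , clip L a ↑ˡ m) (trans (alt-neg (not (not s)) x) (cong (λ r → alt r x) (not-involutive (not s))))

      ↑ˡ≢↑ʳ : ∀ (i : Fin (suc L)) (j : Fin m) → i ↑ˡ m ≢ suc L ↑ʳ j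
      ↑ˡ≢↑ʳ i j e with trans (sym (splitAt-↑ˡ (suc L) i m)) (trans (cong (splitAt (suc L)) e) (splitAt-↑ʳ (suc L) m j))
      ... | ()

      ≼-NonZero : ∀ {n} {x y : Vec Sign n} → x ≼ y → NonZero x → NonZero y
      ≼-NonZero (skip {b = nothing} x≼y) nz = ≼-NonZero x≼y nz
      ≼-NonZero (skip {b = just r} x≼y)  nz = r , refl
      ≼-NonZero (keep {s = r} x≼y)       nz = r , refl

      heavy-heavy : ∀ x y s j → x ≼ y → heavy x ≡ just j → over true j x ≡ s → over true j y ≡ not s → ⊥
      heavy-heavy x y true j x≼y hv ex ey =
        <⇒≱ (≤-trans (over⇒ true j x ex) (∣mask∩∣-mono true x≼y (Class c j))) (¬over⇒ true j y ey)
      heavy-heavy x y false j x≼y hv ex ey = not-both j y (over⇒ true j y ey)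
        (≤-trans (over⇒ false j x (trans (over-true x j hv) (cong not ex))) (∣mask∩∣-mono false x≼y (Class c j)))

      -- Equal indices and opposite leading signs would make the longest alternating subsequence
      -- with first sign `s` shorter in `y` than in `x`, although passing to a larger vector never
      -- shortens it.
      light-light : ∀ x y s → x ≼ y → heavy x ≡ nothing → heavy y ≡ nothing →
                    lead x ≡ just s → lead y ≡ just (not s) →
                    clip L (alt (not s) x) ≡ clip L (alt (not (not s)) y) → ⊥
      light-light x y s x≼y hx hy lx ly e = <-irrefl same
          (≤-trans (≤-reflexive (sym (alt-lead s x lx))) (alt-mono s x≼y))
        where
        same : alt (not s) x ≡ alt s y
        same = trans (sym (toℕ-clip L _ (light-alt x s hx lx)))
              (trans (cong toℕ e)
              (trans (toℕ-clip L _ (light-alt y (not s) hy ly)) (cong (λ r → alt r y) (not-involutive s))))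

      nonComplementary : NonComplementary lab
      nonComplementary x y s i nz x≼y ex ey with heavy x in hx | heavy y in hy
      ... | just j | just j′ with ↑ʳ-injective (suc L) j j′ (trans (cong proj₂ ex) (sym (cong proj₂ ey)))
      ... | refl = heavy-heavy x y s j x≼y hx (cong proj₁ ex) (cong proj₁ ey)
      nonComplementary x y s i nz x≼y ex ey | just j | nothing =
        ↑ˡ≢↑ʳ _ j (trans (cong proj₂ ey) (sym (cong proj₂ ex)))
      nonComplementary x y s i nz x≼y ex ey | nothing | just j =
        ↑ˡ≢↑ʳ _ j (trans (cong proj₂ ex) (sym (cong proj₂ ey)))
      nonComplementary x y s i (r , lx) x≼y ex ey | nothing | nothing with ≼-NonZero x≼y (r , lx)
      ... | r′ , ly rewrite lx | ly with cong proj₁ ex | cong proj₁ ey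
      ... | refl | refl = light-light x y s x≼y hx hy lx ly
        (↑ˡ-injective m _ _ (trans (cong proj₂ ex) (sym (cong proj₂ ey))))

    absurd : ⊥
    absurd = <-irrefl refl (≤-trans (≤-reflexive (trans (cong (_+ m) (sym 2k≡)) (trans (+-comm (k + k) m) (sym length≡))))
                                    (tucker lab antipodal nonComplementary))

  halving : ∃ (Halving c t)
  halving with search-Vec search-Sign N (Halving? c t)
  ... | yes h = h
  ... | no ¬h with sum t in k≡
  ...   | suc k′ = ⊥-elim (NoHalving.absurd k′ k≡ λ x h → ¬h (x , h))
  -- For `k = 0` there is no range of `2k - 1` light indices, but the zero vector is a solution.
  ...   | zero   = ⊥-elim (¬h (x₀ , tight-Halving true x₀ num≤ (≤-trans (≤-reflexive (cong₂ _+_ k≡ k≡)) z≤n)))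
    where
    x₀ : Vec Sign N
    x₀ = replicate N nothing
    ∣mask-zero∣ : ∀ n s (C : Subset n) → ∣ mask s (replicate n nothing) ∩ C ∣ ≡ 0
    ∣mask-zero∣ zero    s []      = refl
    ∣mask-zero∣ (suc n) s (_ ∷ C) = ∣mask-zero∣ n s C
    num≤ : ∀ r j → num r j x₀ ≤ t j
    num≤ r j = ≤-trans (≤-reflexive (∣mask-zero∣ N r (Class c j))) z≤n

-- Splitting in two when some classes have even size

isYes-refl : ∀ {m} (i : Fin m) → ⌊ i ≟ i ⌋ ≡ true
isYes-refl i with i ≟ i
... | yes _  = refl
... | no i≢i = ⊥-elim (i≢i refl)

isYes-≢ : ∀ {m} {i j : Fin m} → i ≢ j → ⌊ i ≟ j ⌋ ≡ false
isYes-≢ {i = i} {j} i≢j with i ≟ j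
... | yes e = ⊥-elim (i≢j e)
... | no _  = refl

bit≤1 : ∀ b → bit b ≤ 1
bit≤1 true  = ≤-refl
bit≤1 false = z≤n

-- Weaker than `IsHalving`, because one omitted vertex leaves an odd rest in an even class. This is
-- the invariant that survives unpadding, while `covers` and `fair` still determine the counts in
-- odd classes exactly.
record IsSplit {N m} (c : Fin N → Fin m) (A : Bool → Subset N) : Set where
  field
    stable   : ∀ s → Stable 2 (A s)
    disjoint : Empty (A true ∩ A false)
    covers   : ∀ j → suc (∣ A true ∩ Class c j ∣ + ∣ A false ∩ Class c j ∣) ≡ ∣ Class c j ∣
    fair     : ∀ s j → ∣ A s ∩ Class c j ∣ ≤ suc ∣ A (not s) ∩ Class c j ∣
    balanced : ∀ s → ∣ A s ∣ ≤ suc ∣ A (not s) ∣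
open IsSplit

-- S arises from T, a set in the path with an additional first vertex of class u, by dropping
-- this vertex and, if b holds, exactly one vertex of class u altogether.
record Shrinks {N m} (c : Fin N → Fin m) (u : Fin m) (b : Bool) (T : Subset (suc N)) (S : Subset N) : Set where
  field
    sub   : ∀ x → x ∈ S → suc x ∈ T
    count : ∀ j → bit (b ∧ ⌊ u ≟ j ⌋) + ∣ S ∩ Class c j ∣ ≡ ∣ T ∩ Class (u ◂ c) j ∣
    total : bit b + ∣ S ∣ ≡ ∣ T ∣
open Shrinks

remove-one : ∀ {N m} (c : Fin N → Fin m) u (S : Subset N) → 0 < ∣ S ∩ Class c u ∣ →
             ∃ λ S′ → S′ ⊆ S × (∀ j → bit ⌊ u ≟ j ⌋ + ∣ S′ ∩ Class c j ∣ ≡ ∣ S ∩ Class c j ∣) × suc ∣ S′ ∣ ≡ ∣ S ∣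
remove-one c u (false ∷ S) pos =
  let (S′ , sub , cnt , tot) = remove-one (c ∘ suc) u S pos
  in false ∷ S′ , (λ { (there x∈) → there (sub x∈) }) , cnt , tot
remove-one c u (true ∷ S) pos with c zero ≟ u
... | yes refl = false ∷ S , (λ { (there x∈) → there x∈ }) , (λ j → sym (∣∷∣ ⌊ c zero ≟ j ⌋ (S ∩ Class (c ∘ suc) j))) , refl
... | no _ =
  let (S′ , sub , cnt , tot) = remove-one (c ∘ suc) u S pos
      step j = begin
        bit ⌊ u ≟ j ⌋ + ∣ ⌊ c zero ≟ j ⌋ ∷ S′ ∩ Class (c ∘ suc) j ∣
          ≡⟨ cong (bit ⌊ u ≟ j ⌋ +_) (∣∷∣ ⌊ c zero ≟ j ⌋ (S′ ∩ Class (c ∘ suc) j)) ⟩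
        bit ⌊ u ≟ j ⌋ + (bit ⌊ c zero ≟ j ⌋ + ∣ S′ ∩ Class (c ∘ suc) j ∣)
          ≡⟨ +-assoc (bit ⌊ u ≟ j ⌋) (bit ⌊ c zero ≟ j ⌋) _ ⟨
        bit ⌊ u ≟ j ⌋ + bit ⌊ c zero ≟ j ⌋ + ∣ S′ ∩ Class (c ∘ suc) j ∣
          ≡⟨ cong (_+ ∣ S′ ∩ Class (c ∘ suc) j ∣) (+-comm (bit ⌊ u ≟ j ⌋) (bit ⌊ c zero ≟ j ⌋)) ⟩
        bit ⌊ c zero ≟ j ⌋ + bit ⌊ u ≟ j ⌋ + ∣ S′ ∩ Class (c ∘ suc) j ∣
          ≡⟨ +-assoc (bit ⌊ c zero ≟ j ⌋) (bit ⌊ u ≟ j ⌋) _ ⟩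
        bit ⌊ c zero ≟ j ⌋ + (bit ⌊ u ≟ j ⌋ + ∣ S′ ∩ Class (c ∘ suc) j ∣)
          ≡⟨ cong (bit ⌊ c zero ≟ j ⌋ +_) (cnt j) ⟩
        bit ⌊ c zero ≟ j ⌋ + ∣ S ∩ Class (c ∘ suc) j ∣
          ≡⟨ ∣∷∣ ⌊ c zero ≟ j ⌋ (S ∩ Class (c ∘ suc) j) ⟨
        ∣ ⌊ c zero ≟ j ⌋ ∷ S ∩ Class (c ∘ suc) j ∣ ∎
  in true ∷ S′ , (λ { here → here ; (there x∈) → there (sub x∈) }) , step , cong suc tot
  where open ≡-Reasoning

shrink-one : ∀ {N m} (c : Fin N → Fin m) u (T : Subset (suc N)) → 0 < ∣ T ∩ Class (u ◂ c) u ∣ → ∃ (Shrinks c u true T)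
shrink-one c u (true ∷ T) pos = T , record
  { sub = λ _ → there ; count = λ j → sym (∣∷∣ ⌊ u ≟ j ⌋ (T ∩ Class c j)) ; total = refl }
shrink-one c u (false ∷ T) pos =
  let (S , S⊆T , cnt , tot) = remove-one c u T pos
  in S , record { sub = λ _ x∈ → there (S⊆T x∈) ; count = cnt ; total = tot }

shrink-none : ∀ {N m} (c : Fin N → Fin m) u (T : Subset (suc N)) → zero ∉ T → ∃ (Shrinks c u false T)
shrink-none c u (true ∷ T)  0∉ = ⊥-elim (0∉ here)
shrink-none c u (false ∷ T) 0∉ = T , record { sub = λ _ → there ; count = λ _ → refl ; total = refl }

same : Bool → Bool → Bool
same true  b = b
same false b = not b

Unpads : ∀ {N m} (c : Fin N → Fin m) (u : Fin m) (σ : Bool) (T : Bool → Subset (suc N)) (S : Bool → Subset N) → Set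
Unpads c u σ T S = ∀ s → Shrinks c u (same s σ) (T s) (S s)

unpad : ∀ {N m} (c : Fin N → Fin m) u (T : Bool → Subset (suc N)) σ →
        0 < ∣ T σ ∩ Class (u ◂ c) u ∣ → zero ∉ T (not σ) →
        ∃ (Unpads c u σ T)
unpad c u T true pos 0∉ = (λ { true → proj₁ a ; false → proj₁ b }) , λ { true → proj₂ a ; false → proj₂ b }
  where
  a = shrink-one c u (T true) pos
  b = shrink-none c u (T false) 0∉
unpad c u T false pos 0∉ = (λ { true → proj₁ b ; false → proj₁ a }) , λ { true → proj₂ b ; false → proj₂ a }
  where
  a = shrink-one c u (T false) pos
  b = shrink-none c u (T true) 0∉

unpad-stable : ∀ {N m} {c : Fin N → Fin m} {u b q T S} → Shrinks c u b T S → Stable q T → Stable q S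
unpad-stable sh st x y x∈ y∈ x≢y = st (suc x) (suc y) (sub sh x x∈) (sub sh y y∈) λ { refl → x≢y refl }

unpad-disjoint : ∀ {N m} {c : Fin N → Fin m} {u b b′ T T′ S S′} → Shrinks c u b T S → Shrinks c u b′ T′ S′ →
                 Empty (T ∩ T′) → Empty (S ∩ S′)
unpad-disjoint {S = S} {S′} sh sh′ em (x , x∈) =
  let (p , p′) = x∈p∩q⁻ S S′ x∈ in em (suc x , x∈p∩q⁺ (sub sh x p , sub sh′ x p′))

unpad-covers : ∀ {N m} (c : Fin N → Fin m) u σ T S → Unpads c u σ T S → ∀ j →
               suc (∣ T true ∩ Class (u ◂ c) j ∣ + ∣ T false ∩ Class (u ◂ c) j ∣) ≡ ∣ Class (u ◂ c) j ∣ →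
               suc (∣ S true ∩ Class c j ∣ + ∣ S false ∩ Class c j ∣) ≡ ∣ Class c j ∣
unpad-covers c u σ T S sh j cov = +-cancelˡ-≡ (bit e) _ _ (begin
  bit e + suc (a + b)                                    ≡⟨ +-suc (bit e) (a + b) ⟩
  suc (bit e + (a + b))                                  ≡⟨ cong suc (spread σ e) ⟩
  suc ((bit (σ ∧ e) + a) + (bit (not σ ∧ e) + b))        ≡⟨ cong suc (cong₂ _+_ (count (sh true) j) (count (sh false) j)) ⟩
  suc (∣ T true ∩ Class (u ◂ c) j ∣ + ∣ T false ∩ Class (u ◂ c) j ∣) ≡⟨ cov ⟩
  ∣ e ∷ Class c j ∣                                      ≡⟨ ∣∷∣ e (Class c j) ⟩
  bit e + ∣ Class c j ∣                                  ∎)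
  where
  open ≡-Reasoning
  e = ⌊ u ≟ j ⌋
  a = ∣ S true ∩ Class c j ∣
  b = ∣ S false ∩ Class c j ∣
  spread : ∀ σ e → bit e + (a + b) ≡ (bit (σ ∧ e) + a) + (bit (not σ ∧ e) + b)
  spread true  true  = refl
  spread true  false = refl
  spread false true  = sym (+-suc a b)
  spread false false = refl

near : ∀ {a b a′ b′} x y → bit x + a ≡ a′ → bit y + b ≡ b′ → a′ ≡ b′ → a ≤ suc b
near {a} {b} x y refl refl e = ≤-trans (m≤n+m a (bit x)) (≤-trans (≤-reflexive e) (+-monoˡ-≤ b (bit≤1 y)))

Even Odd : ℕ → Set
Even n = ∃ λ t → n ≡ t + t
Odd  n = ∃ λ t → n ≡ suc (t + t)

parity : ∀ n → Even n ⊎ Odd n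
parity zero = inj₁ (0 , refl)
parity (suc n) with parity n
... | inj₁ (t , refl) = inj₂ (t , refl)
... | inj₂ (t , refl) = inj₁ (suc t , cong suc (sym (+-suc t t)))

halves : ∀ a b t → a + b ≡ t + t → a ≤ suc b → b ≤ suc a → a ≡ t
halves a b t e a≤ b≤ with a <? t | t <? a
... | yes a<t | _ = ⊥-elim (<-irrefl e (+-mono-<-≤ a<t (≤-trans b≤ a<t)))
... | no _ | yes t<a = ⊥-elim (<-irrefl (sym e) (+-mono-<-≤ t<a (≤-pred (≤-trans t<a a≤))))
... | no a≮t | no t≮a = ≤-antisym (≮⇒≥ t≮a) (≮⇒≥ a≮t)

even-pos : ∀ {v t} → v ≡ t + t → 1 ≤ v → 1 ≤ t
even-pos {t = zero}  refl ()
even-pos {t = suc t} _    _ = s≤s z≤n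

shrink-other : ∀ {N m} {c : Fin N → Fin m} {u b} {T : Subset (suc N)} {S : Subset N} → Shrinks c u b T S →
               ∀ {j} → u ≢ j → ∣ S ∩ Class c j ∣ ≡ ∣ T ∩ Class (u ◂ c) j ∣
shrink-other {b = b} {S = S} sh {j} u≢j = trans
  (cong (λ e → bit e + ∣ S ∩ Class _ j ∣) (sym (trans (cong (b ∧_) (isYes-≢ u≢j)) (∧-zeroʳ b))))
  (count sh j)

∣Class∣-same : ∀ {N m} (c : Fin N → Fin m) u → ∣ Class (u ◂ c) u ∣ ≡ suc ∣ Class c u ∣
∣Class∣-same c u = trans (∣∷∣ ⌊ u ≟ u ⌋ (Class c u)) (cong (λ e → bit e + ∣ Class c u ∣) (isYes-refl u))

∣Class∣-other : ∀ {N m} (c : Fin N → Fin m) {u j} → u ≢ j → ∣ Class (u ◂ c) j ∣ ≡ ∣ Class c j ∣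
∣Class∣-other c {u} {j} u≢j = trans (∣∷∣ ⌊ u ≟ j ⌋ (Class c j)) (cong (λ e → bit e + ∣ Class c j ∣) (isYes-≢ u≢j))

∣Class∣-pos : ∀ {N m} (c : Fin N → Fin m) u → (∀ j → 1 ≤ ∣ Class c j ∣) → ∀ j → 1 ≤ ∣ Class (u ◂ c) j ∣
∣Class∣-pos c u pos j = ≤-trans (pos j) (∣p∣≤∣x∷p∣ ⌊ u ≟ j ⌋ (Class c j))

record IsHalving {N m} (c : Fin N → Fin m) (t : Fin m → ℕ) (A : Bool → Subset N) : Set where
  field
    stable   : ∀ s → Stable 2 (A s)
    disjoint : Empty (A true ∩ A false)
    exact    : ∀ s j → ∣ A s ∩ Class c j ∣ ≡ t j

  total-exact : ∀ s → ∣ A s ∣ ≡ sum t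
  total-exact s = trans (sym (∣∩Class∣-sum c (A s))) (sum-cong-≗ (exact s))

halve : ∀ {N m} (c : Fin N → Fin m) (odd : ∀ j → Odd ∣ Class c j ∣) → ∃ (IsHalving c (proj₁ ∘ odd))
halve c odd =
  let (x , (st₊ , st₋) , exact) = OddClasses.halving c (proj₁ ∘ odd) (proj₂ ∘ odd)
  in (λ s → mask s x) , record
    { stable   = λ { true → st₊ ; false → st₋ }
    ; disjoint = mask-disjoint x
    ; exact    = λ { true j → proj₁ (exact j) ; false j → proj₂ (exact j) }
    }

split-odd : ∀ {N m} (c : Fin N → Fin m) → (∀ j → Odd ∣ Class c j ∣) → ∃ (IsSplit c)
split-odd c odd with halve c odd
... | A , h = A , record
  { stable   = H.stable
  ; disjoint = H.disjoint
  ; covers   = λ j → trans (cong suc (cong₂ _+_ (H.exact true j) (H.exact false j))) (sym (proj₂ (odd j)))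
  ; fair     = λ s j → ≤-trans (≤-reflexive (trans (H.exact s j) (sym (H.exact (not s) j)))) (n≤1+n _)
  ; balanced = λ s → ≤-trans (≤-reflexive (trans (H.total-exact s) (sym (H.total-exact (not s))))) (n≤1+n _)
  }
  where module H = IsHalving h

both-absurd : ∀ {N} {A B : Subset N} → Empty (A ∩ B) → ∀ {x} → x ∈ A → x ∈ B → ⊥
both-absurd em x∈A x∈B = em (_ , x∈p∩q⁺ (x∈A , x∈B))

-- An even class without a partner costs one of the sets one vertex. The padded path is halved
-- exactly, so the resulting difference of one is still allowed.
split-one-even : ∀ {N m} (c : Fin N → Fin m) p → 1 ≤ ∣ Class c p ∣ →
                 (∀ j → Odd ∣ Class (p ◂ c) j ∣) → ∃ (IsSplit c)
split-one-even {N} {m} c p v≥1 odd with halve (p ◂ c) odd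
... | T , h = S , record
  { stable   = λ s → unpad-stable (un s) (H.stable s)
  ; disjoint = unpad-disjoint (un true) (un false) H.disjoint
  ; covers   = λ j → unpad-covers c p σ T S un j
      (trans (cong suc (cong₂ _+_ (H.exact true j) (H.exact false j))) (sym (proj₂ (odd j))))
  ; fair     = λ s j → near (same s σ ∧ ⌊ p ≟ j ⌋) (same (not s) σ ∧ ⌊ p ≟ j ⌋)
      (count (un s) j) (count (un (not s)) j) (trans (H.exact s j) (sym (H.exact (not s) j)))
  ; balanced = λ s → near (same s σ) (same (not s) σ)
      (total (un s)) (total (un (not s))) (trans (H.total-exact s) (sym (H.total-exact (not s))))
  }
  where
  module H = IsHalving h
  compatible : ∃ λ σ → zero ∉ T (not σ)
  -- The set containing the added vertex, if there is one, must be the one charged.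
  compatible with zero ∈? T false
  ... | yes 0∈ = false , λ 0∈′ → both-absurd H.disjoint 0∈′ 0∈
  ... | no 0∉  = true , 0∉
  σ = proj₁ compatible
  t≥1 : 1 ≤ proj₁ (odd p)
  t≥1 = even-pos (suc-injective (trans (sym (∣Class∣-same c p)) (proj₂ (odd p)))) v≥1
  unpadded = unpad c p T σ (≤-trans t≥1 (≤-reflexive (sym (H.exact σ p)))) (proj₂ compatible)
  S = proj₁ unpadded
  un = proj₂ unpadded

-- Two parts of an even number that differ by at most one are equal. This provides the exact counts
-- in the two padded classes of `unpad-two`.
IsSplit-odd-class : ∀ {N m} {c : Fin N → Fin m} {A} → IsSplit c A → ∀ j t → ∣ Class c j ∣ ≡ suc (t + t) →
                    ∀ s → ∣ A s ∩ Class c j ∣ ≡ t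
IsSplit-odd-class {c = c} {A} sp j t v≡ s = at s
  where
  a+b : ∣ A true ∩ Class c j ∣ + ∣ A false ∩ Class c j ∣ ≡ t + t
  a+b = suc-injective (trans (covers sp j) v≡)
  at : ∀ s → ∣ A s ∩ Class c j ∣ ≡ t
  at true  = halves _ _ t a+b (fair sp true j) (fair sp false j)
  at false = halves _ _ t (trans (+-comm ∣ A false ∩ Class c j ∣ _) a+b) (fair sp false j) (fair sp true j)

-- The two additional vertices are adjacent, so they can be charged to different sets.
unpad-two : ∀ {N m} (c : Fin N → Fin m) p d → p ≢ d → (∀ j → 1 ≤ ∣ Class c j ∣) →
            Even ∣ Class c p ∣ → Even ∣ Class c d ∣ → ∃ (IsSplit (p ◂ (d ◂ c))) → ∃ (IsSplit c)
unpad-two {N} {m} c p d p≢d pos (tp , vp) (td , vd) (R , sp) = S , record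
  { stable   = λ s → unpad-stable (un₂ s) (unpad-stable (un₁ s) (stable sp s))
  ; disjoint = unpad-disjoint (un₂ true) (un₂ false) (unpad-disjoint (un₁ true) (un₁ false) (disjoint sp))
  ; covers   = λ j → unpad-covers c d (not σ) T S un₂ j (unpad-covers (d ◂ c) p σ R T un₁ j (covers sp j))
  ; fair     = fair′
  -- Both sets lose exactly one element, so their difference in size is unchanged.
  ; balanced = λ s → ≤-pred (subst₂ _≤_ (sym (total₂ s σ (un₁ s) (un₂ s)))
                                       (cong suc (sym (total₂ (not s) σ (un₁ (not s)) (un₂ (not s))))) (balanced sp s))
  }
  where
  d≢p : d ≢ p
  d≢p = p≢d ∘ sym

  exactₚ : ∀ s → ∣ R s ∩ Class (p ◂ (d ◂ c)) p ∣ ≡ tp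
  exactₚ = IsSplit-odd-class sp p tp
    (trans (∣Class∣-same (d ◂ c) p) (cong suc (trans (∣Class∣-other c d≢p) vp)))

  exact-d : ∀ s → ∣ R s ∩ Class (p ◂ (d ◂ c)) d ∣ ≡ td
  exact-d = IsSplit-odd-class sp d td
    (trans (∣Class∣-other (d ◂ c) p≢d) (trans (∣Class∣-same c d) (cong suc vd)))

  adjacent : ∀ s → zero ∈ R s → suc zero ∈ R s → ⊥
  adjacent s 0∈ 1∈ with stable sp s zero (suc zero) 0∈ 1∈ (λ ())
  ... | s≤s ()

  compatible : ∃ λ σ → zero ∉ R (not σ) × suc zero ∉ R σ
  compatible with zero ∈? R false | suc zero ∈? R true
  ... | no 0∉  | no 1∉ = true , 0∉ , 1∉
  ... | yes 0∈ | _     = false , (λ 0∈′ → both-absurd (disjoint sp) 0∈′ 0∈) , adjacent false 0∈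
  ... | no _   | yes 1∈ = false , (λ 0∈ → adjacent true 0∈ 1∈) , both-absurd (disjoint sp) 1∈

  σ = proj₁ compatible

  unpadded₁ = unpad (d ◂ c) p R σ (≤-trans (even-pos vp (pos p)) (≤-reflexive (sym (exactₚ σ)))) (proj₁ (proj₂ compatible))
  T = proj₁ unpadded₁
  un₁ = proj₂ unpadded₁

  exact-d′ : ∀ s → ∣ T s ∩ Class (d ◂ c) d ∣ ≡ td
  exact-d′ s = trans (shrink-other (un₁ s) p≢d) (exact-d s)

  unpadded₂ = unpad c d T (not σ)
    (≤-trans (even-pos vd (pos d)) (≤-reflexive (sym (exact-d′ (not σ)))))
    (λ 0∈ → proj₂ (proj₂ compatible) (subst (λ r → suc zero ∈ R r) (not-involutive σ) (sub (un₁ (not (not σ))) zero 0∈)))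
  S = proj₁ unpadded₂
  un₂ = proj₂ unpadded₂

  fair′ : ∀ s j → ∣ S s ∩ Class c j ∣ ≤ suc ∣ S (not s) ∩ Class c j ∣
  fair′ s j with p ≟ j
  ... | yes refl = near (same s σ ∧ ⌊ p ≟ p ⌋) (same (not s) σ ∧ ⌊ p ≟ p ⌋)
      (at s) (at (not s)) (trans (exactₚ s) (sym (exactₚ (not s))))
    where
    at : ∀ s → bit (same s σ ∧ ⌊ p ≟ p ⌋) + ∣ S s ∩ Class c p ∣ ≡ ∣ R s ∩ Class (p ◂ (d ◂ c)) p ∣
    at s = trans (cong (bit (same s σ ∧ ⌊ p ≟ p ⌋) +_) (shrink-other (un₂ s) d≢p)) (count (un₁ s) p)
  ... | no p≢j with d ≟ j
  ...   | yes refl = near (same s (not σ) ∧ ⌊ d ≟ d ⌋) (same (not s) (not σ) ∧ ⌊ d ≟ d ⌋)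
      (count (un₂ s) d) (count (un₂ (not s)) d) (trans (exact-d′ s) (sym (exact-d′ (not s))))
  ...   | no d≢j = subst₂ (λ a b → a ≤ suc b) (at s) (at (not s)) (fair sp s j)
    where
    at : ∀ s → ∣ R s ∩ Class (p ◂ (d ◂ c)) j ∣ ≡ ∣ S s ∩ Class c j ∣
    at s = sym (trans (shrink-other (un₂ s) d≢j) (shrink-other (un₁ s) p≢j))

  total₂ : ∀ s σ {R : Subset (suc (suc N))} {T S} → Shrinks (d ◂ c) p (same s σ) R T → Shrinks c d (same s (not σ)) T S →
           suc ∣ S ∣ ≡ ∣ R ∣
  total₂ true  true  u v = trans (cong suc (total v)) (total u)
  total₂ true  false u v = trans (total v) (total u)
  total₂ false true  u v = trans (total v) (total u)
  total₂ false false u v = trans (cong suc (total v)) (total u)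

mutual
  -- The recursion is on the list `ds` of classes not yet known to be odd; the path itself grows by
  -- two vertices with each pair. An even class without a partner waits as `p` in
  -- `split-evens-pending`.
  split-evens : ∀ {N m} ds (c : Fin N → Fin m) → (∀ j → 1 ≤ ∣ Class c j ∣) →
                (∀ j → j ∈ᴸ ds ⊎ Odd ∣ Class c j ∣) → ∃ (IsSplit c)
  split-evens [] c pos odd = split-odd c λ j → only-odd (odd j)
    where
    only-odd : ∀ {j} → j ∈ᴸ [] ⊎ Odd ∣ Class c j ∣ → Odd ∣ Class c j ∣
    only-odd (inj₂ o) = o
  split-evens (d ∷ ds) c pos odd with parity ∣ Class c d ∣
  ... | inj₂ o = split-evens ds c pos λ j → drop-odd (odd j)
    where
    drop-odd : ∀ {j} → j ∈ᴸ d ∷ ds ⊎ Odd ∣ Class c j ∣ → j ∈ᴸ ds ⊎ Odd ∣ Class c j ∣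
    drop-odd (inj₁ (here refl)) = inj₂ o
    drop-odd (inj₁ (there j∈))  = inj₁ j∈
    drop-odd (inj₂ o′)          = inj₂ o′
  ... | inj₁ e = split-evens-pending ds d c pos e λ j j≢d → drop-pending j≢d (odd j)
    where
    drop-pending : ∀ {j} → j ≢ d → j ∈ᴸ d ∷ ds ⊎ Odd ∣ Class c j ∣ → j ∈ᴸ ds ⊎ Odd ∣ Class c j ∣
    drop-pending j≢d (inj₁ (here e))   = ⊥-elim (j≢d e)
    drop-pending j≢d (inj₁ (there j∈)) = inj₁ j∈
    drop-pending j≢d (inj₂ o)          = inj₂ o

  split-evens-pending : ∀ {N m} ds p (c : Fin N → Fin m) → (∀ j → 1 ≤ ∣ Class c j ∣) → Even ∣ Class c p ∣ →
                        (∀ j → j ≢ p → j ∈ᴸ ds ⊎ Odd ∣ Class c j ∣) → ∃ (IsSplit c)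
  split-evens-pending [] p c pos (t , e) odd = split-one-even c p (pos p) odd′
    where
    odd′ : ∀ j → Odd ∣ Class (p ◂ c) j ∣
    odd′ j with p ≟ j
    ... | yes refl = t , cong suc e
    ... | no p≢j with odd j (p≢j ∘ sym)
    ...   | inj₂ o = o
  split-evens-pending (d ∷ ds) p c pos e odd with p ≟ d
  ... | yes refl = split-evens-pending ds p c pos e λ j j≢p → drop-p j≢p (odd j j≢p)
    where
    drop-p : ∀ {j} → j ≢ p → j ∈ᴸ p ∷ ds ⊎ Odd ∣ Class c j ∣ → j ∈ᴸ ds ⊎ Odd ∣ Class c j ∣
    drop-p j≢p (inj₁ (here e))   = ⊥-elim (j≢p e)
    drop-p j≢p (inj₁ (there j∈)) = inj₁ j∈
    drop-p j≢p (inj₂ o)          = inj₂ o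
  ... | no p≢d with parity ∣ Class c d ∣
  ...   | inj₂ o = split-evens-pending ds p c pos e λ j j≢p → drop-odd (odd j j≢p)
    where
    drop-odd : ∀ {j} → j ∈ᴸ d ∷ ds ⊎ Odd ∣ Class c j ∣ → j ∈ᴸ ds ⊎ Odd ∣ Class c j ∣
    drop-odd (inj₁ (here refl)) = inj₂ o
    drop-odd (inj₁ (there j∈))  = inj₁ j∈
    drop-odd (inj₂ o′)          = inj₂ o′
  ...   | inj₁ (td , ed) = unpad-two c p d p≢d pos e (td , ed)
            (split-evens ds (p ◂ (d ◂ c)) (∣Class∣-pos (d ◂ c) p (∣Class∣-pos c d pos)) odd″)
    where
    odd″ : ∀ j → j ∈ᴸ ds ⊎ Odd ∣ Class (p ◂ (d ◂ c)) j ∣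
    odd″ j with p ≟ j | d ≟ j
    ... | yes refl | yes d≡p = ⊥-elim (p≢d (sym d≡p))
    ... | yes refl | no _    = inj₂ (proj₁ e , cong suc (proj₂ e))
    ... | no _     | yes refl = inj₂ (td , cong suc ed)
    ... | no p≢j   | no d≢j with odd j (p≢j ∘ sym)
    ...   | inj₁ (here j≡d) = ⊥-elim (d≢j (sym j≡d))
    ...   | inj₁ (there j∈) = inj₁ j∈
    ...   | inj₂ o          = inj₂ o

split : ∀ {N m} (c : Fin N → Fin m) → (∀ j → 1 ≤ ∣ Class c j ∣) → ∃ (IsSplit c)
split {m = m} c pos = split-evens (allFin m) c pos λ j → inj₁ (∈-allFin j)

-- Classes, unions and the number of uncovered vertices

∈Class⁺ : ∀ {N m} (c : Fin N → Fin m) {j} x → c x ≡ j → x ∈ Class c j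
∈Class⁺ c zero refl with c zero ≟ c zero
... | yes _  = here
... | no neq = ⊥-elim (neq refl)
∈Class⁺ c (suc x) e = there (∈Class⁺ (c ∘ suc) x e)

∈Class⁻ : ∀ {N m} (c : Fin N → Fin m) {j} x → x ∈ Class c j → c x ≡ j
∈Class⁻ c {j} zero x∈ with c zero ≟ j | x∈
... | yes e | _ = e
... | no _  | ()
∈Class⁻ c (suc x) (there x∈) = ∈Class⁻ (c ∘ suc) x x∈

∈Union⁺ : ∀ {r N} (S : Fin r → Subset N) i {x} → x ∈ S i → x ∈ Union S
∈Union⁺ S zero    x∈ = x∈p∪q⁺ (inj₁ x∈)
∈Union⁺ S (suc i) x∈ = x∈p∪q⁺ (inj₂ (∈Union⁺ (S ∘ suc) i x∈))

∈Union⁻ : ∀ {r N} (S : Fin r → Subset N) {x} → x ∈ Union S → ∃ λ i → x ∈ S i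
∈Union⁻ {zero}  S x∈ = ⊥-elim (∉⊥ x∈)
∈Union⁻ {suc r} S x∈ with x∈p∪q⁻ (S zero) (Union (S ∘ suc)) x∈
... | inj₁ x∈₀ = zero , x∈₀
... | inj₂ x∈₁ = let (i , x∈ᵢ) = ∈Union⁻ (S ∘ suc) x∈₁ in suc i , x∈ᵢ

∣∪∣≤ : ∀ {N} (A B : Subset N) → ∣ A ∪ B ∣ ≤ ∣ A ∣ + ∣ B ∣
∣∪∣≤ []          []          = z≤n
∣∪∣≤ (false ∷ A) (false ∷ B) = ∣∪∣≤ A B
∣∪∣≤ (false ∷ A) (true ∷ B)  = ≤-trans (s≤s (∣∪∣≤ A B)) (≤-reflexive (sym (+-suc ∣ A ∣ ∣ B ∣)))
∣∪∣≤ (true ∷ A)  (false ∷ B) = s≤s (∣∪∣≤ A B)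
∣∪∣≤ (true ∷ A)  (true ∷ B)  = s≤s (≤-trans (∣∪∣≤ A B) (+-monoʳ-≤ ∣ A ∣ (n≤1+n _)))

∣∩∣+∣∩∁∣ : ∀ {N} (A V : Subset N) → ∣ A ∩ V ∣ + ∣ V ∩ ∁ A ∣ ≡ ∣ V ∣
∣∩∣+∣∩∁∣ []          []          = refl
∣∩∣+∣∩∁∣ (false ∷ A) (false ∷ V) = ∣∩∣+∣∩∁∣ A V
∣∩∣+∣∩∁∣ (false ∷ A) (true ∷ V)  = trans (+-suc ∣ A ∩ V ∣ _) (cong suc (∣∩∣+∣∩∁∣ A V))
∣∩∣+∣∩∁∣ (true ∷ A)  (false ∷ V) = ∣∩∣+∣∩∁∣ A V
∣∩∣+∣∩∁∣ (true ∷ A)  (true ∷ V)  = cong suc (∣∩∣+∣∩∁∣ A V)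

∩∁∪ : ∀ {N} (V A B : Subset N) → V ∩ ∁ (A ∪ B) ≡ (V ∩ ∁ A) ∩ ∁ B
∩∁∪ []          []          []      = refl
∩∁∪ (false ∷ V) (_ ∷ A)     (_ ∷ B) = cong (false ∷_) (∩∁∪ V A B)
∩∁∪ (true ∷ V)  (false ∷ A) (b ∷ B) = cong (not b ∷_) (∩∁∪ V A B)
∩∁∪ (true ∷ V)  (true ∷ A)  (_ ∷ B) = cong (false ∷_) (∩∁∪ V A B)

∩∁-empty : ∀ {N} (V : Subset N) → V ∩ ∁ (Union {0} λ ()) ≡ V
∩∁-empty []      = refl
∩∁-empty (true ∷ V) = cong (true ∷_) (∩∁-empty V)
∩∁-empty (false ∷ V) = cong (false ∷_) (∩∁-empty V)

∩∁-disjoint : ∀ {N} {A S : Subset N} (V : Subset N) → Empty (A ∩ S) → S ∩ (V ∩ ∁ A) ≡ S ∩ V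
∩∁-disjoint {A = A} {S} V em = ⊆-antisym
  (λ x∈ → let (x∈S , x∈′) = x∈p∩q⁻ S _ x∈ in x∈p∩q⁺ (x∈S , proj₁ (x∈p∩q⁻ V _ x∈′)))
  (λ x∈ → let (x∈S , x∈V) = x∈p∩q⁻ S V x∈ in
          x∈p∩q⁺ (x∈S , x∈p∩q⁺ (x∈V , x∉p⇒x∈∁p λ x∈A → em (_ , x∈p∩q⁺ (x∈A , x∈S)))))

uncovered-sum : ∀ {r N} (S : Fin r → Subset N) → PairwiseDisjoint S → ∀ V →
                ∣ V ∩ ∁ (Union S) ∣ + sum (λ i → ∣ S i ∩ V ∣) ≡ ∣ V ∣
uncovered-sum {zero}  S dis V = trans (+-identityʳ _) (cong ∣_∣ (∩∁-empty V))
uncovered-sum {suc r} S dis V = begin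
  ∣ V ∩ ∁ (S zero ∪ U) ∣ + (a + sum (λ i → ∣ S (suc i) ∩ V ∣))
    ≡⟨ cong₂ (λ x y → x + (a + y)) (cong ∣_∣ (∩∁∪ V (S zero) U))
         (sum-cong-≗ λ i → cong ∣_∣ (sym (∩∁-disjoint V (dis zero (suc i) λ ())))) ⟩
  ∣ V′ ∩ ∁ U ∣ + (a + sum (λ i → ∣ S (suc i) ∩ V′ ∣))
    ≡⟨ swap ∣ V′ ∩ ∁ U ∣ a (sum (λ i → ∣ S (suc i) ∩ V′ ∣)) ⟩
  a + (∣ V′ ∩ ∁ U ∣ + sum (λ i → ∣ S (suc i) ∩ V′ ∣))
    ≡⟨ cong (a +_) (uncovered-sum (S ∘ suc) (λ i j i≢j → dis (suc i) (suc j) λ { refl → i≢j refl }) V′) ⟩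
  a + ∣ V′ ∣
    ≡⟨ ∣∩∣+∣∩∁∣ (S zero) V ⟩
  ∣ V ∣ ∎
  where
  open ≡-Reasoning
  U  = Union (S ∘ suc)
  V′ = V ∩ ∁ (S zero)
  a  = ∣ S zero ∩ V ∣
  swap : ∀ x y z → x + (y + z) ≡ y + (x + z)
  swap = solve-∀

-- Subpaths

emb : ∀ {N} (X : Subset N) → Fin ∣ X ∣ → Fin N
emb (true ∷ X)  zero    = zero
emb (true ∷ X)  (suc y) = suc (emb X y)
emb (false ∷ X) y       = suc (emb X y)

expand : ∀ {N} (X : Subset N) → Subset ∣ X ∣ → Subset N
expand []          []      = []
expand (true ∷ X)  (b ∷ F) = b ∷ expand X F
expand (false ∷ X) F       = false ∷ expand X F

emb-∈ : ∀ {N} (X : Subset N) y → emb X y ∈ X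
emb-∈ (true ∷ X)  zero    = here
emb-∈ (true ∷ X)  (suc y) = there (emb-∈ X y)
emb-∈ (false ∷ X) y       = there (emb-∈ X y)

∈-emb : ∀ {N} (X : Subset N) {x} → x ∈ X → ∃ λ y → emb X y ≡ x
∈-emb (true ∷ X)  here       = zero , refl
∈-emb (true ∷ X)  (there x∈) = let (y , e) = ∈-emb X x∈ in suc y , cong suc e
∈-emb (false ∷ X) (there x∈) = let (y , e) = ∈-emb X x∈ in y , cong suc e

emb-injective : ∀ {N} (X : Subset N) y y′ → emb X y ≡ emb X y′ → y ≡ y′
emb-injective (true ∷ X)  zero    zero     e = refl
emb-injective (true ∷ X)  (suc y) (suc y′) e = cong suc (emb-injective X y y′ (Finₚ.suc-injective e))
emb-injective (false ∷ X) y       y′       e = emb-injective X y y′ (Finₚ.suc-injective e)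

∈-expand⁺ : ∀ {N} (X : Subset N) F {y} → y ∈ F → emb X y ∈ expand X F
∈-expand⁺ (true ∷ X)  (_ ∷ F) here       = here
∈-expand⁺ (true ∷ X)  (_ ∷ F) (there y∈) = there (∈-expand⁺ X F y∈)
∈-expand⁺ (false ∷ X) F       y∈         = there (∈-expand⁺ X F y∈)

∈-expand⁻ : ∀ {N} (X : Subset N) F {x} → x ∈ expand X F → ∃ λ y → emb X y ≡ x × y ∈ F
∈-expand⁻ (true ∷ X)  (_ ∷ F) here       = zero , refl , here
∈-expand⁻ (true ∷ X)  (_ ∷ F) (there x∈) = let (y , e , y∈) = ∈-expand⁻ X F x∈ in suc y , cong suc e , there y∈
∈-expand⁻ (false ∷ X) F       (there x∈) = let (y , e , y∈) = ∈-expand⁻ X F x∈ in y , cong suc e , y∈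

∣expand∣ : ∀ {N} (X : Subset N) F → ∣ expand X F ∣ ≡ ∣ F ∣
∣expand∣ []          []          = refl
∣expand∣ (true ∷ X)  (true ∷ F)  = cong suc (∣expand∣ X F)
∣expand∣ (true ∷ X)  (false ∷ F) = ∣expand∣ X F
∣expand∣ (false ∷ X) F           = ∣expand∣ X F

∣expand∩Class∣ : ∀ {N m} (c : Fin N → Fin m) (X : Subset N) F j →
                 ∣ expand X F ∩ Class c j ∣ ≡ ∣ F ∩ Class (c ∘ emb X) j ∣
∣expand∩Class∣ c []          []      j = refl
∣expand∩Class∣ c (true ∷ X)  (b ∷ F) j = trans (∣∷∣ e (expand X F ∩ Class (c ∘ suc) j))
  (trans (cong (bit e +_) (∣expand∩Class∣ (c ∘ suc) X F j)) (sym (∣∷∣ e (F ∩ Class (c ∘ suc ∘ emb X) j))))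
  where e = b ∧ ⌊ c zero ≟ j ⌋
∣expand∩Class∣ c (false ∷ X) F       j = ∣expand∩Class∣ (c ∘ suc) X F j

∣Class-emb∣ : ∀ {N m} (c : Fin N → Fin m) (X : Subset N) j → ∣ Class (c ∘ emb X) j ∣ ≡ ∣ X ∩ Class c j ∣
∣Class-emb∣ c []          j = refl
∣Class-emb∣ c (true ∷ X)  j = trans (∣∷∣ e (Class (c ∘ suc ∘ emb X) j))
  (trans (cong (bit e +_) (∣Class-emb∣ (c ∘ suc) X j)) (sym (∣∷∣ e (X ∩ Class (c ∘ suc) j))))
  where e = ⌊ c zero ≟ j ⌋
∣Class-emb∣ c (false ∷ X) j = ∣Class-emb∣ (c ∘ suc) X j

mutual
  -- The vertex just before `X` is taken, so the first vertex of the remaining path is blocked; this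
  -- gains the one extra unit of distance per element.
  emb-after : ∀ {N} (X : Subset N) → Stable 2 (true ∷ X) → ∀ y → suc (2 * toℕ y) ≤ toℕ (emb X y)
  emb-after (true ∷ X)  st y with st zero (suc zero) here (there here) (λ ())
  ... | s≤s ()
  emb-after (false ∷ X) st y = s≤s (emb-lower X (Stable-tail (Stable-tail st)) y)

  emb-lower : ∀ {N} (X : Subset N) → Stable 2 X → ∀ y → 2 * toℕ y ≤ toℕ (emb X y)
  emb-lower (true ∷ X)  st zero    = z≤n
  emb-lower (true ∷ X)  st (suc y) = ≤-trans (≤-reflexive (*-suc 2 (toℕ y))) (s≤s (emb-after X st y))
  emb-lower (false ∷ X) st y       = m≤n⇒m≤1+n (emb-lower X (Stable-tail st) y)

emb-distance : ∀ {N} (X : Subset N) → Stable 2 X → ∀ y y′ →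
               2 * ∣ toℕ y - toℕ y′ ∣ ≤ ∣ toℕ (emb X y) - toℕ (emb X y′) ∣
emb-distance (true ∷ X)  st zero    zero     = z≤n
emb-distance (true ∷ X)  st zero    (suc y′) = emb-lower (true ∷ X) st (suc y′)
emb-distance (true ∷ X)  st (suc y) zero     = emb-lower (true ∷ X) st (suc y)
emb-distance (true ∷ X)  st (suc y) (suc y′) = emb-distance X (Stable-tail st) y y′
emb-distance (false ∷ X) st y       y′       = emb-distance X (Stable-tail st) y y′

expand-Stable : ∀ {N h} (X : Subset N) F → Stable 2 X → Stable h F → Stable (2 * h) (expand X F)
expand-Stable X F stX stF x x′ x∈ x′∈ x≢x′ with ∈-expand⁻ X F x∈ | ∈-expand⁻ X F x′∈
... | y , refl , y∈ | y′ , refl , y′∈ =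
  ≤-trans (*-monoʳ-≤ 2 (stF y y′ y∈ y′∈ (x≢x′ ∘ cong (emb X)))) (emb-distance X stX y y′)

-- Doubling

-- The field `lower` is the floor bound without division: the quotient of the class size plus one by
-- `q` is below `2 + a`, so its floor is at most `1 + a`.
record IsGood (q : ℕ) {N m} (c : Fin N → Fin m) (S : Fin q → Subset N) : Set where
  field
    stable    : ∀ i → Stable q (S i)
    disjoint  : PairwiseDisjoint S
    uncovered : ∀ j → ∣ Class c j ∩ ∁ (Union S) ∣ < q
    lower     : ∀ i j → suc ∣ Class c j ∣ < q * (2 + ∣ S i ∩ Class c j ∣)

record IsFair (q : ℕ) {N m} (c : Fin N → Fin m) (S : Fin q → Subset N) : Set where
  field
    good   : IsGood q c S
    -- |S i| differs by less than 1 from (N - m (q - 1)) / q.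
    total≤ : ∀ i → q * ∣ S i ∣ + m * q < N + q + m
    total≥ : ∀ i → N + m < q * ∣ S i ∣ + q + m * q
  open IsGood good public

fair-1 : ∀ {N m} (c : Fin N → Fin m) → ∃ (IsFair 1 c)
fair-1 {N} {m} c = (λ _ → ⊤) , record
  { good = record
    { stable    = λ _ x y _ _ x≢y → n≢0⇒n>0 λ e → x≢y (Finₚ.toℕ-injective (∣m-n∣≡0⇒m≡n e))
    ; disjoint  = λ { zero zero 0≢0 → ⊥-elim (0≢0 refl) }
    ; uncovered = λ j → s≤s (≤-reflexive (none j))
    ; lower     = λ _ j → ≤-reflexive (trans (cong (2 +_) (sym (cong ∣_∣ (∩-identityˡ (Class c j))))) (sym (*-identityˡ _)))
    }
  ; total≤ = λ _ → ≤-reflexive (trans (cong (λ a → suc (1 * a + m * 1)) (∣⊤∣≡n N)) (eq₁ N m))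
  ; total≥ = λ _ → ≤-reflexive (trans (eq₂ N m) (cong (λ a → 1 * a + 1 + m * 1) (sym (∣⊤∣≡n N))))
  }
  where
  eq₁ : ∀ N m → suc (1 * N + m * 1) ≡ N + 1 + m
  eq₁ = solve-∀
  eq₂ : ∀ N m → suc (N + m) ≡ 1 * N + 1 + m * 1
  eq₂ = solve-∀
  none : ∀ j → ∣ Class c j ∩ ∁ (Union {1} λ _ → ⊤) ∣ ≡ 0
  none j = +-cancelʳ-≡ ∣ Class c j ∣ _ 0 (trans
    (cong (∣ Class c j ∩ ∁ (Union {1} λ _ → ⊤) ∣ +_) (sym (trans (+-identityʳ _) (cong ∣_∣ (∩-identityˡ (Class c j))))))
    (uncovered-sum {1} (λ _ → ⊤) (λ { zero zero 0≢0 → ⊥-elim (0≢0 refl) }) (Class c j)))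

side : Fin 2 → Bool
side zero       = true
side (suc zero) = false

index : Bool → Fin 2
index true  = zero
index false = suc zero

module _ {N m : ℕ} {c : Fin N → Fin m} {A : Bool → Subset N} (sp : IsSplit c A) where
  private module A = IsSplit sp

  split-lower : ∀ s j → ∣ Class c j ∣ ≤ 2 * suc ∣ A s ∩ Class c j ∣
  split-lower s j = ≤-trans (≤-reflexive (sym (A.covers j))) (bound s)
    where
    eq : ∀ a → suc (a + suc a) ≡ 2 * suc a
    eq = solve-∀
    bound : ∀ s → suc (∣ A true ∩ Class c j ∣ + ∣ A false ∩ Class c j ∣) ≤ 2 * suc ∣ A s ∩ Class c j ∣
    bound true  = ≤-trans (s≤s (+-monoʳ-≤ _ (A.fair false j))) (≤-reflexive (eq _))
    bound false = ≤-trans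
      (s≤s (≤-trans (≤-reflexive (+-comm ∣ A true ∩ Class c j ∣ _)) (+-monoʳ-≤ _ (A.fair true j))))
      (≤-reflexive (eq _))

  split-length : N ≡ m + (∣ A true ∣ + ∣ A false ∣)
  split-length = begin
    N
      ≡⟨ ∣Class∣-sum c ⟨
    sum (λ j → ∣ Class c j ∣)
      ≡⟨ sum-cong-≗ (λ j → sym (A.covers j)) ⟩
    sum (λ j → 1 + (∣ A true ∩ Class c j ∣ + ∣ A false ∩ Class c j ∣))
      ≡⟨ ∑-distrib-+ (λ _ → 1) (λ j → ∣ A true ∩ Class c j ∣ + ∣ A false ∩ Class c j ∣) ⟩
    sum {m} (λ _ → 1) + sum (λ j → ∣ A true ∩ Class c j ∣ + ∣ A false ∩ Class c j ∣)
      ≡⟨ cong₂ _+_ (trans (sum-const m 1) (*-identityʳ m))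
                   (∑-distrib-+ (λ j → ∣ A true ∩ Class c j ∣) (λ j → ∣ A false ∩ Class c j ∣)) ⟩
    m + (sum (λ j → ∣ A true ∩ Class c j ∣) + sum (λ j → ∣ A false ∩ Class c j ∣))
      ≡⟨ cong (m +_) (cong₂ _+_ (∣∩Class∣-sum c (A true)) (∣∩Class∣-sum c (A false))) ⟩
    m + (∣ A true ∣ + ∣ A false ∣) ∎
    where open ≡-Reasoning

  split-length-side : ∀ s → N ≡ m + (∣ A s ∣ + ∣ A (not s) ∣)
  split-length-side true  = split-length
  split-length-side false = trans split-length (cong (m +_) (+-comm ∣ A true ∣ _))

  split-total≤ : ∀ s → 2 * ∣ A s ∣ + m ≤ suc N
  split-total≤ s = begin
    2 * a + m              ≡⟨ eq a m ⟩
    m + (a + a)            ≤⟨ +-monoʳ-≤ m (+-monoʳ-≤ a (A.balanced s)) ⟩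
    m + (a + suc ∣ A (not s) ∣) ≡⟨ eq′ m a ∣ A (not s) ∣ ⟩
    suc (m + (a + ∣ A (not s) ∣)) ≡⟨ cong suc (split-length-side s) ⟨
    suc N                  ∎
    where
    open ≤-Reasoning
    a = ∣ A s ∣
    eq : ∀ a m → 2 * a + m ≡ m + (a + a)
    eq = solve-∀
    eq′ : ∀ m a b → m + (a + suc b) ≡ suc (m + (a + b))
    eq′ = solve-∀

  split-total≥ : ∀ s → N ≤ suc (2 * ∣ A s ∣ + m)
  split-total≥ s = begin
    N                        ≡⟨ split-length-side s ⟩
    m + (a + ∣ A (not s) ∣)  ≤⟨ +-monoʳ-≤ m (+-monoʳ-≤ a (swapped s)) ⟩
    m + (a + suc a)          ≡⟨ eq m a ⟩
    suc (2 * a + m)          ∎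
    where
    open ≤-Reasoning
    a = ∣ A s ∣
    swapped : ∀ s → ∣ A (not s) ∣ ≤ suc ∣ A s ∣
    swapped true  = A.balanced false
    swapped false = A.balanced true
    eq : ∀ m a → m + (a + suc a) ≡ suc (2 * a + m)
    eq = solve-∀

  split-disjoint : PairwiseDisjoint (A ∘ side)
  split-disjoint zero       zero       i≢j = ⊥-elim (i≢j refl)
  split-disjoint zero       (suc zero) i≢j = A.disjoint
  split-disjoint (suc zero) zero       i≢j (x , x∈) =
    let (p , p′) = x∈p∩q⁻ (A false) (A true) x∈ in A.disjoint (x , x∈p∩q⁺ (p′ , p))
  split-disjoint (suc zero) (suc zero) i≢j = ⊥-elim (i≢j refl)

  split-uncovered : ∀ j → ∣ Class c j ∩ ∁ (Union (A ∘ side)) ∣ ≡ 1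
  split-uncovered j = +-cancelʳ-≡ (a + (b + 0)) _ 1
    (trans (uncovered-sum (A ∘ side) split-disjoint (Class c j))
           (trans (sym (A.covers j)) (cong (λ z → suc (a + z)) (sym (+-identityʳ b)))))
    where
    a = ∣ A true ∩ Class c j ∣
    b = ∣ A false ∩ Class c j ∣

  module Doubling {h : ℕ} (F : ∀ s → Fin h → Subset ∣ A s ∣) (fr : ∀ s → IsFair h (c ∘ emb (A s)) (F s)) where
    private
      module F s = IsFair (fr s)

      joined : Fin 2 × Fin h → Subset N
      joined (k , l) = expand (A (side k)) (F (side k) l)

      S : Fin (2 * h) → Subset N
      S i = joined (remQuot h i)

      joined-disjoint : ∀ k l k′ l′ → (k , l) ≢ (k′ , l′) → Empty (joined (k , l) ∩ joined (k′ , l′))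
      joined-disjoint k l k′ l′ ne (x , x∈)
        with x∈p∩q⁻ (joined (k , l)) (joined (k′ , l′)) x∈
      ... | p , p′ with ∈-expand⁻ (A (side k)) (F (side k) l) p | ∈-expand⁻ (A (side k′)) (F (side k′) l′) p′ | k ≟ k′
      ... | y , refl , y∈ | y′ , e , y′∈ | no k≢k′ =
        split-disjoint k k′ k≢k′ (_ , x∈p∩q⁺ (emb-∈ (A (side k)) y , subst (_∈ A (side k′)) e (emb-∈ (A (side k′)) y′)))
      ... | y , refl , y∈ | y′ , e , y′∈ | yes refl with emb-injective (A (side k)) y′ y e
      ...   | refl = F.disjoint (side k) l l′ (λ { refl → ne refl }) (y , x∈p∩q⁺ (y∈ , y′∈))

      remQuot-injective : ∀ i i′ → remQuot {2} h i ≡ remQuot h i′ → i ≡ i′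
      remQuot-injective i i′ e = trans (sym (combine-remQuot {2} h i))
        (trans (cong (λ kl → combine (proj₁ kl) (proj₂ kl)) e) (combine-remQuot {2} h i′))

      left : ∀ s j → Subset ∣ A s ∣
      left s j = Class (c ∘ emb (A s)) j ∩ ∁ (Union (F s))

      rest : Fin m → Subset N
      rest j = Class c j ∩ ∁ (Union (A ∘ side))

      classify : ∀ j → Class c j ∩ ∁ (Union S) ⊆ rest j ∪ (expand (A true) (left true j) ∪ expand (A false) (left false j))
      classify j {x} x∈ with x∈p∩q⁻ (Class c j) _ x∈
      ... | x∈C , x∈∁ = find (x ∈? A true) (x ∈? A false)
        where
        inside : ∀ s → x ∈ A s → x ∈ expand (A s) (left s j)
        inside s x∈A with ∈-emb (A s) x∈A
        ... | y , refl = ∈-expand⁺ (A s) (left s j) (x∈p∩q⁺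
            (∈Class⁺ (c ∘ emb (A s)) y (∈Class⁻ c _ x∈C) , x∉p⇒x∈∁p not-in))
          where
          not-in : y ∉ Union (F s)
          not-in y∈ with ∈Union⁻ (F s) y∈
          ... | l , y∈F = x∈∁p⇒x∉p x∈∁ (∈Union⁺ S (combine (index s) l)
            (subst (λ kl → emb (A s) y ∈ joined kl) (sym (remQuot-combine (index s) l)) (in-joined s y∈F)))
            where
            in-joined : ∀ s {y} → y ∈ F s l → emb (A s) y ∈ joined (index s , l)
            in-joined true  = ∈-expand⁺ (A true) (F true l)
            in-joined false = ∈-expand⁺ (A false) (F false l)
        find : Dec (x ∈ A true) → Dec (x ∈ A false) → _
        find (yes p) _       = x∈p∪q⁺ (inj₂ (x∈p∪q⁺ (inj₁ (inside true p))))
        find (no _)  (yes p) = x∈p∪q⁺ (inj₂ (x∈p∪q⁺ (inj₂ (inside false p))))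
        find (no ¬p) (no ¬p′) = x∈p∪q⁺ (inj₁ (x∈p∩q⁺ (x∈C , x∉p⇒x∈∁p outside)))
          where
          outside : x ∉ Union (A ∘ side)
          outside x∈U with ∈Union⁻ (A ∘ side) x∈U
          ... | zero     , q = ¬p q
          ... | suc zero , q = ¬p′ q

      uncovered′ : ∀ j → ∣ Class c j ∩ ∁ (Union S) ∣ < 2 * h
      uncovered′ j = begin-strict
        ∣ Class c j ∩ ∁ (Union S) ∣
          ≤⟨ p⊆q⇒∣p∣≤∣q∣ (classify j) ⟩
        ∣ rest j ∪ (expand (A true) (left true j) ∪ expand (A false) (left false j)) ∣
          ≤⟨ ≤-trans (∣∪∣≤ (rest j) _) (+-monoʳ-≤ _ (∣∪∣≤ (expand (A true) (left true j)) _)) ⟩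
        ∣ rest j ∣ + (∣ expand (A true) (left true j) ∣ + ∣ expand (A false) (left false j) ∣)
          ≡⟨ cong₂ _+_ (split-uncovered j) (cong₂ _+_ (∣expand∣ (A true) _) (∣expand∣ (A false) _)) ⟩
        suc ∣ left true j ∣ + ∣ left false j ∣
          -- The one vertex lost in the split and at most `h - 1` in each half make at most
          -- `2h - 1`.
          <⟨ +-mono-≤-< (F.uncovered true j) (F.uncovered false j) ⟩
        h + h
          ≡⟨ cong (h +_) (+-identityʳ h) ⟨
        2 * h ∎
        where open ≤-Reasoning

      lower′ : ∀ s l j → suc ∣ Class c j ∣ < 2 * h * (2 + ∣ expand (A s) (F s l) ∩ Class c j ∣)
      lower′ s l j = begin-strict
        suc ∣ Class c j ∣
          ≤⟨ s≤s (split-lower s j) ⟩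
        suc (2 * suc n)
          <⟨ ≤-reflexive (eq n) ⟩
        2 * suc (suc n)
          ≡⟨ cong (λ a → 2 * suc (suc a)) (∣Class-emb∣ c (A s) j) ⟨
        2 * suc (suc ∣ Class (c ∘ emb (A s)) j ∣)
          ≤⟨ *-monoʳ-≤ 2 (F.lower s l j) ⟩
        2 * (h * (2 + ∣ F s l ∩ Class (c ∘ emb (A s)) j ∣))
          ≡⟨ *-assoc 2 h _ ⟨
        2 * h * (2 + ∣ F s l ∩ Class (c ∘ emb (A s)) j ∣)
          ≡⟨ cong (λ a → 2 * h * (2 + a)) (∣expand∩Class∣ c (A s) (F s l) j) ⟨
        2 * h * (2 + ∣ expand (A s) (F s l) ∩ Class c j ∣) ∎
        where
        open ≤-Reasoning
        n = ∣ A s ∩ Class c j ∣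
        eq : ∀ n → suc (suc (2 * suc n)) ≡ 2 * suc (suc n)
        eq = solve-∀

      -- The slack of one in the bound for the half is doubled: one unit pays for the parity error
      -- in `split-total≤`, the other keeps the inequality strict.
      total≤′ : ∀ s l → 2 * h * ∣ expand (A s) (F s l) ∣ + m * (2 * h) < N + 2 * h + m
      total≤′ s l = ≤-pred (begin
        suc (suc (2 * h * ∣ expand (A s) (F s l) ∣ + m * (2 * h)))
          ≡⟨ cong (λ T → suc (suc (2 * h * T + m * (2 * h)))) (∣expand∣ (A s) (F s l)) ⟩
        suc (suc (2 * h * T + m * (2 * h)))
          ≡⟨ eq₁ h T m ⟩
        2 * suc (h * T + m * h)
          ≤⟨ *-monoʳ-≤ 2 (F.total≤ s l) ⟩
        2 * (∣ A s ∣ + h + m)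
          ≡⟨ eq₂ ∣ A s ∣ h m ⟩
        (2 * ∣ A s ∣ + m) + (2 * h + m)
          ≤⟨ +-monoˡ-≤ (2 * h + m) (split-total≤ s) ⟩
        suc N + (2 * h + m)
          ≡⟨ cong suc (+-assoc N (2 * h) m) ⟨
        suc (N + 2 * h + m) ∎)
        where
        open ≤-Reasoning
        T = ∣ F s l ∣
        eq₁ : ∀ h T m → suc (suc (2 * h * T + m * (2 * h))) ≡ 2 * suc (h * T + m * h)
        eq₁ = solve-∀
        eq₂ : ∀ a h m → 2 * (a + h + m) ≡ (2 * a + m) + (2 * h + m)
        eq₂ = solve-∀

      total≥′ : ∀ s l → N + m < 2 * h * ∣ expand (A s) (F s l) ∣ + 2 * h + m * (2 * h)
      total≥′ s l = begin
        suc (N + m)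
          ≤⟨ s≤s (+-monoˡ-≤ m (split-total≥ s)) ⟩
        suc (suc (2 * ∣ A s ∣ + m) + m)
          ≡⟨ eq₁ ∣ A s ∣ m ⟩
        2 * suc (∣ A s ∣ + m)
          ≤⟨ *-monoʳ-≤ 2 (F.total≥ s l) ⟩
        2 * (h * T + h + m * h)
          ≡⟨ eq₂ h T m ⟩
        2 * h * T + 2 * h + m * (2 * h)
          ≡⟨ cong (λ T → 2 * h * T + 2 * h + m * (2 * h)) (∣expand∣ (A s) (F s l)) ⟨
        2 * h * ∣ expand (A s) (F s l) ∣ + 2 * h + m * (2 * h) ∎
        where
        open ≤-Reasoning
        T = ∣ F s l ∣
        eq₁ : ∀ a m → suc (suc (2 * a + m) + m) ≡ 2 * suc (a + m)
        eq₁ = solve-∀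
        eq₂ : ∀ h T m → 2 * (h * T + h + m * h) ≡ 2 * h * T + 2 * h + m * (2 * h)
        eq₂ = solve-∀

    fair-double : ∃ (IsFair (2 * h) c)
    fair-double = S , record
      { good = record
        { stable    = λ i → let (k , l) = remQuot {2} h i in
                            expand-Stable (A (side k)) (F (side k) l) (A.stable (side k)) (F.stable (side k) l)
        ; disjoint  = λ i i′ i≢i′ → joined-disjoint _ _ _ _ (i≢i′ ∘ remQuot-injective i i′)
        ; uncovered = uncovered′
        ; lower     = λ i j → let (k , l) = remQuot {2} h i in lower′ (side k) l j
        }
      ; total≤ = λ i → let (k , l) = remQuot {2} h i in total≤′ (side k) l
      ; total≥ = λ i → let (k , l) = remQuot {2} h i in total≥′ (side k) l
      }

-- The size condition is inherited by the halves: if `n` vertices of a class V lie in a half, then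
-- `2 * 2 ^ t ≤ |V| + 1` and `|V| ≤ 2 * (n + 1)` give `2 ^ t ≤ n + 1`. It keeps classes nonempty as
-- long as another split is due.
fair-2^ : ∀ t {N m} (c : Fin N → Fin m) → (∀ j → 2 ^ t ≤ suc ∣ Class c j ∣) → ∃ (IsFair (2 ^ t) c)
fair-2^ zero    c size = fair-1 c
fair-2^ (suc t) c size =
  let (A , sp) = split c (λ j → ≤-pred (≤-trans (*-monoʳ-≤ 2 (m^n>0 2 t)) (size j)))
      rec s = fair-2^ t (c ∘ emb (A s)) λ j → ≤-pred (*-cancelˡ-< 2 (2 ^ t) _
        (≤-trans (s≤s (≤-trans (size j) (s≤s (split-lower sp s j))))
                 (≤-reflexive (trans (eq _) (cong (λ a → 2 * suc (suc a)) (sym (∣Class-emb∣ c (A s) j)))))))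
  in Doubling.fair-double sp (λ s → proj₁ (rec s)) (λ s → proj₂ (rec s))
  where
  eq : ∀ n → suc (suc (2 * suc n)) ≡ 2 * suc (suc n)
  eq = solve-∀

-- From the invariants to the required bounds

floorDiv-lower : ∀ a q n → a < q * (2 + n) → floorDiv a q ∸ 1 ≤ n
floorDiv-lower a zero    n _ = z≤n
floorDiv-lower a (suc q) n a< = m≤n+o⇒m∸n≤o (a / suc q) 1
  (≤-pred (m<n*o⇒m/o<n (≤-trans a< (≤-reflexive (*-comm (suc q) (2 + n))))))

IsGood⇒GoodFamily : ∀ q {N m} {c : Fin N → Fin m} {S} → IsGood q c S → GoodFamily q N m c S
IsGood⇒GoodFamily q {c = c} {S} gd =
    G.stable , G.disjoint , (λ j → <⇒≤pred (G.uncovered j))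
  , λ i j → floorDiv-lower _ q _ (≤-trans (≤-reflexive (cong suc (+-comm ∣ Class c j ∣ 1))) (G.lower i j))
  where module G = IsGood gd

-- Two integers at distance less than one from a common number differ by less than two.
IsFair⇒Balanced : ∀ q {N m} {c : Fin N → Fin m} {S} → IsFair q c S → Balanced S
IsFair⇒Balanced q {N} {m} {c} {S} fr i j = ≤-pred (*-cancelˡ-< q _ _ (+-cancelʳ-< (m * q) _ _ (begin-strict
  q * ∣ S i ∣ + m * q          <⟨ IsFair.total≤ fr i ⟩
  N + q + m                    ≡⟨ eq₁ N q m ⟩
  N + m + q                    ≤⟨ +-monoˡ-≤ q (<⇒≤ (IsFair.total≥ fr j)) ⟩
  q * ∣ S j ∣ + q + m * q + q  ≡⟨ eq₂ q ∣ S j ∣ m ⟩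
  q * (2 + ∣ S j ∣) + m * q    ∎)))
  where
  open ≤-Reasoning
  eq₁ : ∀ N q m → N + q + m ≡ N + m + q
  eq₁ = solve-∀
  eq₂ : ∀ q T m → q * T + q + m * q + q ≡ q * (2 + T) + m * q
  eq₂ = solve-∀

-- Exact splittings from the chromatic number

Equisplit : ∀ q {N m} → (Fin N → Fin m) → (Fin m → ℕ) → (Fin q → Subset N) → Set
Equisplit q c t S = (∀ i → Stable q (S i)) × PairwiseDisjoint S × (∀ i j → ∣ S i ∩ Class c j ∣ ≡ t j)

Equisplit? : ∀ q {N m} (c : Fin N → Fin m) t S → Dec (Equisplit q c t S)
Equisplit? q c t S =
  (all? λ i → Stable? q (S i)) ×-dec
  (all? λ i → all? λ j → ¬? (i ≟ j) →-dec ¬? (nonempty? (S i ∩ S j))) ×-dec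
  (all? λ i → all? λ j → ∣ S i ∩ Class c j ∣ ≟ⁿ t j)

-- The search enumerates vectors of subsets, and a family agrees with `lookup` of its tabulation
-- only pointwise.
Equisplit-cong : ∀ {q N m} {c : Fin N → Fin m} {t} {S S′ : Fin q → Subset N} → (∀ i → S i ≡ S′ i) →
                 Equisplit q c t S → Equisplit q c t S′
Equisplit-cong {q} {c = c} {t} e (st , dis , exact) =
    (λ i → subst (Stable q) (e i) (st i))
  , (λ i j i≢j → subst₂ (λ A B → Empty (A ∩ B)) (e i) (e j) (dis i j i≢j))
  , (λ i j → subst (λ A → ∣ A ∩ Class c j ∣ ≡ t j) (e i) (exact i j))

sum-*ˡ : ∀ {m} a (f : Fin m → ℕ) → sum (λ j → a * f j) ≡ a * sum f
sum-*ˡ {zero}  a f = sym (*-zeroʳ a)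
sum-*ˡ {suc m} a f = trans (cong (a * f zero +_) (sum-*ˡ a (f ∘ suc))) (sym (*-distribˡ-+ a (f zero) _))

module ExactClasses (q′ : ℕ) {N m : ℕ} (c : Fin N → Fin m) (t : Fin m → ℕ)
                    (exact : ∀ j → suc ∣ Class c j ∣ ≡ suc (suc q′) * suc (t j)) where
  private
    q b : ℕ
    b = suc q′
    q = suc b

  Equisplit⇒IsGood : ∀ {S} → Equisplit q c t S → IsGood q c S
  Equisplit⇒IsGood {S} (st , dis , ex) = record
    { stable    = st
    ; disjoint  = dis
    ; uncovered = λ j → ≤-reflexive (+-cancelʳ-≡ (q * t j) _ q (begin
        suc (∣ Class c j ∩ ∁ (Union S) ∣ + q * t j)
          ≡⟨ cong (λ z → suc (∣ Class c j ∩ ∁ (Union S) ∣ + z)) (trans (sum-cong-≗ (λ i → ex i j)) (sum-const q (t j))) ⟨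
        suc (∣ Class c j ∩ ∁ (Union S) ∣ + sum (λ i → ∣ S i ∩ Class c j ∣))
          ≡⟨ cong suc (uncovered-sum S dis (Class c j)) ⟩
        suc ∣ Class c j ∣
          ≡⟨ exact j ⟩
        q * suc (t j)
          ≡⟨ *-suc q (t j) ⟩
        q + q * t j ∎))
    ; lower     = λ i j → subst₂ (λ v a → v < q * (2 + a)) (sym (exact j)) (sym (ex i j)) (*-monoʳ-< q (n<1+n (suc (t j))))
    }
    where open ≡-Reasoning

  colour : ∀ {k} → KGVertex q N k → Fin (suc m)
  colour (F , _) with any? (λ j → t j <? ∣ F ∩ Class c j ∣)
  ... | yes (j , _) = suc j
  ... | no _        = zero

  colour-suc : ∀ {k} (F : KGVertex q N k) j → colour F ≡ suc j → t j < ∣ proj₁ F ∩ Class c j ∣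
  colour-suc (F , _) j e with any? (λ j → t j <? ∣ F ∩ Class c j ∣)
  colour-suc (F , _) j refl | yes (.j , p) = p

  colour-zero : ∀ {k} (F : KGVertex q N k) → colour F ≡ zero → ∀ j → ∣ proj₁ F ∩ Class c j ∣ ≤ t j
  colour-zero (F , _) e j with any? (λ j → t j <? ∣ F ∩ Class c j ∣)
  ... | no none = ≮⇒≥ λ p → none (j , p)

  -- A common colour `suc j` would require `q * suc (t j)` vertices of a class that is one smaller.
  -- With the common colour `zero` all class bounds hold, and the cardinality `sum t` makes them
  -- equalities.
  colour-proper : (∀ S → ¬ Equisplit q c t S) → ProperColouring q N (sum t) (suc m) colour
  colour-proper none F dis mono with colour (F zero) in e
  ... | suc j = <-irrefl refl (begin-strict
      ∣ Class c j ∣                            <⟨ ≤-refl ⟩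
      suc ∣ Class c j ∣                        ≡⟨ exact j ⟩
      q * suc (t j)                            ≡⟨ sum-const q (suc (t j)) ⟨
      sum {q} (λ _ → suc (t j))                ≤⟨ sum-mono (λ i → colour-suc (F i) j (trans (mono i zero) e)) ⟩
      sum (λ i → ∣ proj₁ (F i) ∩ Class c j ∣)  ≤⟨ m≤n+m _ ∣ Class c j ∩ ∁ (Union (proj₁ ∘ F)) ∣ ⟩
      ∣ Class c j ∩ ∁ (Union (proj₁ ∘ F)) ∣ + sum (λ i → ∣ proj₁ (F i) ∩ Class c j ∣)
                                               ≡⟨ uncovered-sum (proj₁ ∘ F) dis (Class c j) ⟩
      ∣ Class c j ∣                            ∎)
    where open ≤-Reasoning
  ... | zero = none (proj₁ ∘ F) ((λ i → proj₂ (proj₂ (F i))) , dis , λ i →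
      sum-tight (colour-zero (F i) (trans (mono i zero) e))
        (≤-reflexive (sym (trans (∣∩Class∣-sum c (proj₁ (F i))) (proj₁ (proj₂ (F i)))))))

  length≡ : N ≡ q * sum t + m * b
  length≡ = +-cancelˡ-≡ m _ _ (begin
    m + N
      ≡⟨ cong₂ _+_ (trans (sum-const m 1) (*-identityʳ m)) (∣Class∣-sum c) ⟨
    sum {m} (λ _ → 1) + sum (λ j → ∣ Class c j ∣)
      ≡⟨ ∑-distrib-+ (λ _ → 1) (λ j → ∣ Class c j ∣) ⟨
    sum (λ j → suc ∣ Class c j ∣)
      ≡⟨ sum-cong-≗ exact ⟩
    sum (λ j → q * suc (t j))
      ≡⟨ sum-*ˡ q (suc ∘ t) ⟩
    q * sum (λ j → 1 + t j)
      ≡⟨ cong (q *_) (trans (∑-distrib-+ (λ _ → 1) t) (cong (_+ sum t) (trans (sum-const m 1) (*-identityʳ m)))) ⟩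
    q * (m + sum t)
      ≡⟨ eq b m (sum t) ⟩
    m + (q * sum t + m * b) ∎)
    where
    open ≡-Reasoning
    eq : ∀ b m k → suc b * (m + k) ≡ m + (suc b * k + m * b)
    eq = solve-∀

  equisplit : KneserHypothesis q → ∃ (Equisplit q c t)
  equisplit kneser with search-Vec anySubset? q (λ v → Equisplit? q c t (lookup v))
  ... | yes (v , eqs) = lookup v , eqs
  ... | no none with sum t in k≡
  -- The hypothesis on chromatic numbers begins at `k = 1`; if the sum is zero, every `t j` is zero
  -- and empty sets suffice.
  ...   | zero = (λ _ → ∅)
          , (λ _ x y x∈ → ⊥-elim (∉⊥ x∈))
          , (λ _ _ _ (x , x∈) → ∉⊥ (proj₁ (x∈p∩q⁻ ∅ ∅ x∈)))
          , λ _ j → trans (trans (cong ∣_∣ (∩-zeroˡ (Class c j))) (∣⊥∣≡0 N))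
                          (sum-tight {f = λ _ → 0} (λ _ → z≤n) (≤-trans (≤-reflexive k≡) z≤n) j)
  ...   | suc k = ⊥-elim (<-irrefl refl (begin-strict
      suc m                                <⟨ ≤-refl ⟩
      2 + m                                ≡⟨ m*n/n≡m (2 + m) b ⟨
      -- Rounding up adds `b - 1`, which is `q′`, and `q + q′` equals `2 * b`: the division is exact
      -- and its value exceeds the number of colours used by one.
      ((2 + m) * b) / b                    ≡⟨ cong (_/ b) (eq q′ m) ⟩
      (q + m * b + q′) / b                 ≡⟨ cong (λ a → ceilDiv a b) (m+n∸m≡n (q * k) (q + m * b)) ⟨
      ceilDiv (q * k + (q + m * b) ∸ q * k) b
        ≡⟨ cong (λ n → ceilDiv (n ∸ q * k) b) length₂ ⟨
      ceilDiv (N ∸ q * k) b                ≤⟨ proj₂ (kneser (suc k) N (s≤s z≤n) qk≤N) (suc m) colourable ⟩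
      suc m                                ∎))
    where
    open ≤-Reasoning
    eq : ∀ q′ m → (2 + m) * suc q′ ≡ suc (suc q′) + m * suc q′ + q′
    eq = solve-∀
    eq′ : ∀ q k x → q * suc k + x ≡ q * k + (q + x)
    eq′ = solve-∀
    length₁ : N ≡ q * suc k + m * b
    length₁ = trans length≡ (cong (λ k → q * k + m * b) k≡)
    length₂ : N ≡ q * k + (q + m * b)
    length₂ = trans length₁ (eq′ q k (m * b))
    qk≤N : q * suc k ≤ N
    qk≤N = ≤-trans (m≤m+n _ (m * b)) (≤-reflexive (sym length₁))
    colourable : Colourable q N (suc k) (suc m)
    colourable = subst (λ k → Colourable q N k (suc m)) k≡ (colour , colour-proper λ S eqs →
      none (tabulate S , Equisplit-cong (λ i → sym (lookup∘tabulate S i)) eqs))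

-- Padding by a block of vertices of one class

pad : ∀ p {N m} → Fin m → (Fin N → Fin m) → Fin (p + N) → Fin m
pad zero    u c = c
pad (suc p) u c = u ◂ pad p u c

suffix : ∀ p {N} → Subset (p + N) → Subset N
suffix zero    S       = S
suffix (suc p) (_ ∷ S) = suffix p S

∈-suffix⁻ : ∀ p {N} (S : Subset (p + N)) {x} → x ∈ suffix p S → p ↑ʳ x ∈ S
∈-suffix⁻ zero    S       x∈ = x∈
∈-suffix⁻ (suc p) (_ ∷ S) x∈ = there (∈-suffix⁻ p S x∈)

∈-suffix⁺ : ∀ p {N} (S : Subset (p + N)) {x} → p ↑ʳ x ∈ S → x ∈ suffix p S
∈-suffix⁺ zero    S       x∈         = x∈
∈-suffix⁺ (suc p) (_ ∷ S) (there x∈) = ∈-suffix⁺ p S x∈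

∣suffix∣≤ : ∀ p {N} (S : Subset (p + N)) → ∣ suffix p S ∣ ≤ ∣ S ∣
∣suffix∣≤ zero    S       = ≤-refl
∣suffix∣≤ (suc p) (b ∷ S) = ≤-trans (∣suffix∣≤ p S) (∣p∣≤∣x∷p∣ b S)

pad-↑ʳ : ∀ p {N m} u (c : Fin N → Fin m) x → pad p u c (p ↑ʳ x) ≡ c x
pad-↑ʳ zero    u c x = refl
pad-↑ʳ (suc p) u c x = pad-↑ʳ p u c x

∣Class-pad∣-same : ∀ p {N m} u (c : Fin N → Fin m) → ∣ Class (pad p u c) u ∣ ≡ p + ∣ Class c u ∣
∣Class-pad∣-same zero    u c = refl
∣Class-pad∣-same (suc p) u c = trans (∣Class∣-same (pad p u c) u) (cong suc (∣Class-pad∣-same p u c))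

∣Class-pad∣-other : ∀ p {N m} {u j} (c : Fin N → Fin m) → u ≢ j → ∣ Class (pad p u c) j ∣ ≡ ∣ Class c j ∣
∣Class-pad∣-other zero    c u≢j = refl
∣Class-pad∣-other (suc p) {u = u} c u≢j = trans (∣Class∣-other (pad p u c) u≢j) (∣Class-pad∣-other p c u≢j)

∣∩Class-pad∣-other : ∀ p {N m} {u j} (c : Fin N → Fin m) S → u ≢ j →
                     ∣ S ∩ Class (pad p u c) j ∣ ≡ ∣ suffix p S ∩ Class c j ∣
∣∩Class-pad∣-other zero    c S       u≢j = refl
∣∩Class-pad∣-other (suc p) {u = u} {j} c (b ∷ S) u≢j = trans
  (cong (λ e → ∣ e ∷ S ∩ Class (pad p u c) j ∣) (trans (cong (b ∧_) (isYes-≢ u≢j)) (∧-zeroʳ b)))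
  (∣∩Class-pad∣-other p c S u≢j)

∣∩Class-pad∣-clear : ∀ p {N m} u j (c : Fin N → Fin m) S → (∀ y → y ∈ S → p ≤ toℕ y) →
                     ∣ S ∩ Class (pad p u c) j ∣ ≡ ∣ suffix p S ∩ Class c j ∣
∣∩Class-pad∣-clear zero    u j c S           clear = refl
∣∩Class-pad∣-clear (suc p) u j c (true ∷ S)  clear with clear zero here
... | ()
∣∩Class-pad∣-clear (suc p) u j c (false ∷ S) clear =
  ∣∩Class-pad∣-clear p u j c S λ y y∈ → ≤-pred (clear (suc y) (there y∈))

∣∩Class-pad∣≤ : ∀ {q} p {N m} u j (c : Fin N → Fin m) S → p ≤ q → Stable q S →
                ∣ S ∩ Class (pad p u c) j ∣ ≤ suc ∣ suffix p S ∩ Class c j ∣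
∣∩Class-pad∣≤ zero    u j c S           p≤q st = n≤1+n _
∣∩Class-pad∣≤ (suc p) u j c (false ∷ S) p<q st = ∣∩Class-pad∣≤ p u j c S (<⇒≤ p<q) (Stable-tail st)
∣∩Class-pad∣≤ (suc p) u j c (true ∷ S)  p<q st = begin
  ∣ ⌊ u ≟ j ⌋ ∷ S ∩ Class (pad p u c) j ∣           ≡⟨ ∣∷∣ ⌊ u ≟ j ⌋ (S ∩ Class (pad p u c) j) ⟩
  bit ⌊ u ≟ j ⌋ + ∣ S ∩ Class (pad p u c) j ∣       ≤⟨ +-monoˡ-≤ _ (bit≤1 ⌊ u ≟ j ⌋) ⟩
  suc ∣ S ∩ Class (pad p u c) j ∣                   ≡⟨ cong suc (∣∩Class-pad∣-clear p u j c S λ y y∈ →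
                                                        ≤-pred (≤-trans p<q (st zero (suc y) here (there y∈) λ ()))) ⟩
  suc ∣ suffix p S ∩ Class c j ∣                    ∎
  where open ≤-Reasoning

-- On the padded class `lower` reads `q * suc t < q * (2 + a)`, that is, `t ≤ a`. The loss of one
-- vertex is affordable because the class itself has shrunk below the multiple `q * suc t`; this
-- strictness is where `0 < p` enters.
unpad-block : ∀ {q} p {N m} u (c : Fin N → Fin m) t → 0 < p → p < q → suc (p + ∣ Class c u ∣) ≡ q * suc t →
              ∀ S → IsGood q (pad p u c) S → IsGood q c (suffix p ∘ S)
unpad-block {q} p u c t 0<p p<q exact S gd = record
  { stable    = λ i x y x∈ y∈ x≢y → ≤-trans
      (G.stable i (p ↑ʳ x) (p ↑ʳ y) (∈-suffix⁻ p (S i) x∈) (∈-suffix⁻ p (S i) y∈) (x≢y ∘ ↑ʳ-injective p x y))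
      (≤-reflexive (trans (cong₂ ∣_-_∣ (toℕ-↑ʳ p x) (toℕ-↑ʳ p y)) (∣m+n-m+o∣≡∣n-o∣ p (toℕ x) (toℕ y))))
  ; disjoint  = λ { i j i≢j (x , x∈) → let (a , b) = x∈p∩q⁻ (suffix p (S i)) _ x∈ in
      G.disjoint i j i≢j (p ↑ʳ x , x∈p∩q⁺ (∈-suffix⁻ p (S i) a , ∈-suffix⁻ p (S j) b)) }
  ; uncovered = λ j → ≤-<-trans
      (≤-trans (p⊆q⇒∣p∣≤∣q∣ (uncovered⊆ j)) (∣suffix∣≤ p (Class (pad p u c) j ∩ ∁ (Union S))))
      (G.uncovered j)
  ; lower     = lower′
  }
  where
  module G = IsGood gd

  uncovered⊆ : ∀ j → Class c j ∩ ∁ (Union (suffix p ∘ S)) ⊆ suffix p (Class (pad p u c) j ∩ ∁ (Union S))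
  uncovered⊆ j {x} x∈ = ∈-suffix⁺ p _ (x∈p∩q⁺
    ( ∈Class⁺ (pad p u c) (p ↑ʳ x) (trans (pad-↑ʳ p u c x) (∈Class⁻ c x (proj₁ split∈)))
    , x∉p⇒x∈∁p λ x∈U → let (i , x∈S) = ∈Union⁻ S x∈U in
        x∈∁p⇒x∉p (proj₂ split∈) (∈Union⁺ (suffix p ∘ S) i (∈-suffix⁺ p (S i) x∈S))))
    where split∈ = x∈p∩q⁻ (Class c j) _ x∈

  lower′ : ∀ i j → suc ∣ Class c j ∣ < q * (2 + ∣ suffix p (S i) ∩ Class c j ∣)
  lower′ i j with u ≟ j
  ... | no u≢j = subst₂ (λ v a → suc v < q * (2 + a))
          (∣Class-pad∣-other p c u≢j) (∣∩Class-pad∣-other p c (S i) u≢j) (G.lower i j)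
  ... | yes refl = begin-strict
      suc ∣ Class c u ∣                              <⟨ s≤s (+-monoˡ-≤ ∣ Class c u ∣ 0<p) ⟩
      suc (p + ∣ Class c u ∣)                        ≡⟨ exact ⟩
      q * suc t                                      ≤⟨ *-monoʳ-≤ q (s≤s t≤) ⟩
      q * suc ∣ S i ∩ Class (pad p u c) u ∣          ≤⟨ *-monoʳ-≤ q (s≤s (∣∩Class-pad∣≤ p u u c (S i) (<⇒≤ p<q) (G.stable i))) ⟩
      q * (2 + ∣ suffix p (S i) ∩ Class c u ∣)       ∎
    where
    open ≤-Reasoning
    t≤ : t ≤ ∣ S i ∩ Class (pad p u c) u ∣
    t≤ = ≤-pred (≤-pred (*-cancelˡ-< q (suc t) _ 
           (≤-trans (≤-reflexive (cong suc (sym (trans (cong suc (∣Class-pad∣-same p u c)) exact)))) (G.lower i u))))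

next-multiple : ∀ q n → ∃ λ p → ∃ λ t → p < suc q × p + n ≡ suc q * t
next-multiple q zero = 0 , 0 , s≤s z≤n , sym (*-zeroʳ (suc q))
next-multiple q (suc n) with next-multiple q n
... | suc p , t , p<q , e = p , t , <-trans ≤-refl p<q , trans (+-suc p n) e
... | zero  , t , _   , e = q , suc t , ≤-refl , trans (+-suc q n) (trans (cong (suc q +_) e) (sym (*-suc (suc q) t)))

Exact : ℕ → ∀ {N m} → (Fin N → Fin m) → Fin m → Set
Exact q c j = ∃ λ t → suc ∣ Class c j ∣ ≡ q * suc t

block-size : ∀ q {N m} (c : Fin N → Fin m) u → ∃ λ p → ∃ λ t → p < suc q × suc (p + ∣ Class c u ∣) ≡ suc q * suc t
block-size q c u with next-multiple q (suc ∣ Class c u ∣)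
... | p , suc t , p<q , e = p , t , p<q , trans (sym (+-suc p _)) e
... | p , zero  , p<q , e with trans (sym (+-suc p ∣ Class c u ∣)) (trans e (*-zeroʳ (suc q)))
...   | ()

-- The blocks are stacked in front class by class and removed in reverse order. Each consists of
-- consecutive vertices of one class, and removing it preserves `IsGood`, although not exactness.
good-pad : ∀ q′ → let q = suc (suc q′) in KneserHypothesis q → ∀ {m} ds {N} (c : Fin N → Fin m) →
           (∀ j → j ∈ᴸ ds ⊎ Exact q c j) → ∃ (IsGood q c)
good-pad q′ kneser [] c ex = let (S , eqs) = ExactClasses.equisplit q′ c (proj₁ ∘ exact) (proj₂ ∘ exact) kneser
                             in S , ExactClasses.Equisplit⇒IsGood q′ c (proj₁ ∘ exact) (proj₂ ∘ exact) eqs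
  where
  exact : ∀ j → Exact (suc (suc q′)) c j
  exact j with ex j
  ... | inj₂ e = e
good-pad q′ kneser (d ∷ ds) c ex with block-size (suc q′) c d
... | p , t , p<q , e = remove p p<q e (good-pad q′ kneser ds (pad p d c) ex′)
  where
  q = suc (suc q′)
  ex′ : ∀ j → j ∈ᴸ ds ⊎ Exact q (pad p d c) j
  ex′ j with d ≟ j
  ... | yes refl = inj₂ (t , trans (cong suc (∣Class-pad∣-same p d c)) e)
  ... | no d≢j with ex j
  ...   | inj₁ (here j≡d)  = ⊥-elim (d≢j (sym j≡d))
  ...   | inj₁ (there j∈)  = inj₁ j∈
  ...   | inj₂ (t′ , e′)   = inj₂ (t′ , trans (cong suc (∣Class-pad∣-other p c d≢j)) e′)
  remove : ∀ p → p < q → suc (p + ∣ Class c d ∣) ≡ q * suc t → ∃ (IsGood q (pad p d c)) → ∃ (IsGood q c)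
  -- An empty block yields no strict decrease, but there is nothing to remove either.
  remove zero    _   _ good     = good
  remove (suc p) p<q e (S , gd) = suffix (suc p) ∘ S , unpad-block (suc p) d c t (s≤s z≤n) p<q e S gd

theorem7p2 : (∀ (q : ℕ) → 2 ≤ q → KneserHypothesis q →
    ∀ (N m : ℕ) (c : Fin N → Fin m) → ClassesAtLeast q c →
    Σ (Fin q → Subset N) (λ S → GoodFamily q N m c S))
    ×
    (∀ (t : ℕ) → let q = 2 ^ suc t in
    ∀ (N m : ℕ) (c : Fin N → Fin m) → ClassesAtLeast q c →
    Σ (Fin q → Subset N) (λ S → GoodFamily q N m c S × Balanced S))
theorem7p2 = from-Kneser , powers-of-two
  where
  from-Kneser : ∀ q → 2 ≤ q → KneserHypothesis q → ∀ N m (c : Fin N → Fin m) → ClassesAtLeast q c →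
                Σ (Fin q → Subset N) (GoodFamily q N m c)
  from-Kneser (suc zero) (s≤s ())
  from-Kneser (suc (suc q′)) _ kneser N m c _ =
    let (S , gd) = good-pad q′ kneser (allFin m) c (λ j → inj₁ (∈-allFin j))
    in S , IsGood⇒GoodFamily (suc (suc q′)) gd

  powers-of-two : ∀ t → let q = 2 ^ suc t in ∀ N m (c : Fin N → Fin m) → ClassesAtLeast q c →
                  Σ (Fin q → Subset N) (λ S → GoodFamily q N m c S × Balanced S)
  powers-of-two t N m c size =
    let (S , fr) = fair-2^ (suc t) c (λ j → ≤-trans (m≤n+m∸n (2 ^ suc t) 1) (s≤s (size j)))
    in S , IsGood⇒GoodFamily (2 ^ suc t) (IsFair.good fr) , IsFair⇒Balanced (2 ^ suc t) fr
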